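{- Let $s,t$ be integers, let $(U_n)_{n\ge 0}$ be the Lucas sequence and $(P_n)_{n\ge 1}$ the sequence of Lucas atoms associated with $(s,t)$. Let $p\geq 3$ be a prime number with $p\nmid t$, and let $k=\rho(p,U)$ be the rank of appearance of $p$ in $(U_n)_{n\ge 0}$. Then for every integer $n\ge 1$, \[ v_p(P_n)=\begin{cases} v_p(U_k) & \text{if } n=k,\\ 1 & \text{if } n=kp^h \text{ for some integer } h\geq 1,\\ 0 & \text{otherwise.}\end{cases} \]
   Context: Lucas sequence: for integers $s,t$, $U_0=0$, $U_1=1$, $U_n=sU_{n-1}+tU_{n-2}$ for $n\ge 2$. Lucas atoms: for $n\ge 1$ let $\Phi_n(\alpha,\beta)=\prod_{1\le j\le n,\ \gcd(j,n)=1}(\alpha-\omega^j\beta)$, with $\omega$ a primitive $n$-th root of unity (the homogenization of the $n$-th cyclotomic polynomial). Put $P_1(s,t)=1$, and for $n\ge 2$ let $P_n(s,t)\in\mathbb Z[s,t]$ be the unique polynomial with $P_n(\alpha+\beta,-\alpha\beta)=\Phi_n(\alpha,\beta)$ as polynomials in the variables $\alpha,\beta$. For integers $s,t$, $P_n$ denotes the integer value $P_n(s,t)$. The rank of appearance $\rho(p,U)$ is the least integer $k\ge 1$ with $p\mid U_k$ (it exists when $p\nmid t$). $v_p$ is the $p$-adic valuation, with $v_p(0)=+\infty$. -}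

module Defs where

open import Algebra.Bundles using (CommutativeRing)
open import Algebra.Bundles.Raw using (RawRing)
import Algebra.Definitions
import Algebra.Definitions.RawSemiring
open import Data.Integer.Base as ℤ using (ℤ; +_; -[1+_]; 0ℤ; 1ℤ)
import Data.Integer.Divisibility as ℤ
open import Data.List.Base using (List; []; _∷_; map; foldr; filter; applyUpTo)
open import Data.Nat.Base as ℕ using (ℕ; zero; suc)
import Data.Nat.Properties as ℕ
open import Data.Nat.Divisibility using (_∣?_)
open import Data.Nat.GCD using (gcd)
open import Data.Product.Base using (_×_)
open import Level using (0ℓ; _⊔_) renaming (suc to lsuc)
open import Relation.Binary.PropositionalEquality using (_≡_)
open import Relation.Nullary.Construct.Add.Supremum using (_⁺; ⊤⁺; [_])
open import Relation.Nullary.Decidable.Core using (yes; no)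
open import Relation.Nullary.Negation.Core using (¬_)

-- A polynomial is a list of coefficients, constant term first. Trailing zeros
-- are allowed, so equality of polynomials is equality of all coefficients.

module Polynomial {c ℓ} (R : RawRing c ℓ) where
  open RawRing R

  coeff : List Carrier → ℕ → Carrier
  coeff []      _       = 0#
  coeff (a ∷ _) zero    = a
  coeff (_ ∷ f) (suc i) = coeff f i

  add : List Carrier → List Carrier → List Carrier
  add []      g       = g
  add (a ∷ f) []      = a ∷ f
  add (a ∷ f) (b ∷ g) = a + b ∷ add f g

  mul : List Carrier → List Carrier → List Carrier
  mul []      _ = []
  mul (a ∷ f) g = add (map (a *_) g) (0# ∷ mul f g)

  ring : RawRing c ℓ
  ring = record
    { Carrier = List Carrier
    ; _≈_     = λ f g → ∀ i → coeff f i ≈ coeff g i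
    ; _+_     = add
    ; _*_     = mul
    ; -_      = map -_
    ; 0#      = []
    ; 1#      = 1# ∷ []
    }

  const : Carrier → List Carrier
  const a = a ∷ []

  var : List Carrier
  var = 0# ∷ 1# ∷ []

_[X] : ∀ {c ℓ} → RawRing c ℓ → RawRing c ℓ
R [X] = Polynomial.ring R

-- R[x, y] is (R[x])[y].

_[X,Y] : ∀ {c ℓ} → RawRing c ℓ → RawRing c ℓ
R [X,Y] = R [X] [X]

ℤ[s,t] : RawRing 0ℓ 0ℓ
ℤ[s,t] = ℤ.+-*-rawRing [X,Y]

-- The value of a polynomial in ℤ[s,t] at elements s, t of an arbitrary ring.

module Evaluation {c ℓ} (R : RawRing c ℓ) where
  open RawRing R
  open Algebra.Definitions.RawSemiring rawSemiring using () renaming (_×_ to _×ᴿ_)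

  fromℤ : ℤ → Carrier
  fromℤ (+ n)    = n ×ᴿ 1#
  fromℤ -[1+ n ] = - (suc n ×ᴿ 1#)

  horner : ∀ {a} {A : Set a} → (A → Carrier) → Carrier → List A → Carrier
  horner φ x []      = 0#
  horner φ x (a ∷ f) = φ a + x * horner φ x f

  eval : RawRing.Carrier ℤ[s,t] → Carrier → Carrier → Carrier
  eval P s t = horner (horner fromℤ s) t P

-- An integral domain of characteristic zero with a chosen primitive n-th root
-- of unity ω n for each n ≥ 1. The model to keep in mind is ℂ, or the algebraic
-- closure of ℚ; the value ω 0 is irrelevant. The domain axiom is stated as
-- cancellation of nonzero elements because equality need not be decidable.

record DomainWithRootsOfUnity c ℓ : Set (lsuc (c ⊔ ℓ)) where
  field
    commutativeRing : CommutativeRing c ℓ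

  open CommutativeRing commutativeRing public
  open Algebra.Definitions _≈_ using (AlmostLeftCancellative)
  open Algebra.Definitions.RawSemiring (RawRing.rawSemiring rawRing) public
    using (_^_) renaming (_×_ to _×ᴿ_)

  PrimitiveRoot : ℕ → Carrier → Set ℓ
  PrimitiveRoot n x = x ^ n ≈ 1# × (∀ m → 1 ℕ.≤ m → m ℕ.< n → ¬ x ^ m ≈ 1#)

  field
    *-cancelˡ-nonZero  : AlmostLeftCancellative 0# _*_
    characteristicZero : ∀ n → 1 ℕ.≤ n → ¬ n ×ᴿ 1# ≈ 0#
    ω                  : ℕ → Carrier
    ω-primitive        : ∀ n → 1 ℕ.≤ n → PrimitiveRoot n (ω n)

module LucasAtoms {c ℓ} (K : DomainWithRootsOfUnity c ℓ) where
  private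
    module K = DomainWithRootsOfUnity K

  K[α,β] : RawRing c ℓ
  K[α,β] = K.rawRing [X,Y]

  open RawRing K[α,β]

  scalar : K.Carrier → Carrier
  scalar a = Polynomial.const (K.rawRing [X]) (Polynomial.const K.rawRing a)

  α β : Carrier
  α = Polynomial.const (K.rawRing [X]) (Polynomial.var K.rawRing)
  β = Polynomial.var (K.rawRing [X])

  totatives : ℕ → List ℕ
  totatives n = filter (λ j → gcd j n ℕ.≟ 1) (applyUpTo suc n)

  Φ : ℕ → Carrier
  Φ n = foldr _*_ 1# (map (λ j → α + - (scalar (K.ω n K.^ j) * β)) (totatives n))

  -- These conditions determine P n for every n ≥ 1; P 0 is irrelevant.

  record IsLucasAtoms (P : ℕ → RawRing.Carrier ℤ[s,t]) : Set ℓ where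
    field
      P₁ : RawRing._≈_ ℤ[s,t] (P 1) (RawRing.1# ℤ[s,t])
      Pₙ : ∀ n → 2 ℕ.≤ n → Evaluation.eval K[α,β] (P n) (α + β) (- (α * β)) ≈ Φ n

open LucasAtoms public using (IsLucasAtoms)

_⟨_,_⟩ : RawRing.Carrier ℤ[s,t] → ℤ → ℤ → ℤ
P ⟨ s , t ⟩ = Evaluation.eval ℤ.+-*-rawRing P s t

U : ℤ → ℤ → ℕ → ℤ
U s t 0             = 0ℤ
U s t 1             = 1ℤ
U s t (suc (suc n)) = s ℤ.* U s t (suc n) ℤ.+ t ℤ.* U s t n

record IsRankOfAppearance (p : ℕ) (u : ℕ → ℤ) (k : ℕ) : Set where
  field
    positive : 1 ℕ.≤ k
    divides  : + p ℤ.∣ u k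
    least    : ∀ j → 1 ℕ.≤ j → + p ℤ.∣ u j → k ℕ.≤ j

-- The largest e ≤ b such that p ^ e divides m.

maxExponent : (p m b : ℕ) → ℕ
maxExponent p m zero    = 0
maxExponent p m (suc b) with (p ℕ.^ suc b) ∣? m
... | yes _ = suc b
... | no  _ = maxExponent p m b

-- For p ≥ 2 and m ≥ 1, p ^ e ∣ m forces e < m, so the bound m loses nothing.

valuationℕ : ℕ → ℕ → ℕ ⁺
valuationℕ p zero      = ⊤⁺
valuationℕ p m@(suc _) = [ maxExponent p m m ]

v : ℕ → ℤ → ℕ ⁺
v p x = valuationℕ p ℤ.∣ x ∣

{-# OPTIONS --safe #-}

-- Adjoin to K the roots α, β of x² − s x − t. The elements ω_dⁱ with d ∣ Nm, d ∤ N and i prime to d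
-- are distinct zeros of Σ_{i<m} x^{Ni}, and writing the fractions j/(Nm) with m ∤ j in lowest terms
-- shows that there are at least as many of them as its degree. So they are all its zeros, and
-- homogenising at α, β gives ∏ P_d(s,t) = U_m(V_N, −(−t)^N) over the d ∣ Nm with d ∤ N, where
-- V_N = α^N + β^N: the right-hand side stands for U_{Nm} / U_N also when U_N = 0.
--
-- The Lucas sequence on the right has discriminant (s² + 4t) U_N², divisible by p² if k ∣ N, and
-- modulo a divisor of its discriminant U_m(S, T) is m (S/2)^{m−1}. If n = k pᵃ m with p ∤ m > 1, take
-- N = k pᵃ: p does not divide the product, hence not its factor P_n. If k ∤ n, take N = 1 instead,
-- as p ∤ U_n. For n = k (with N = 1) and n = k p^h (with N = k p^{h−1}, m = p) the other factors of
-- the product are therefore prime to p, and the valuation of P_n is that of the right-hand side.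

module Submission where

open import Defs
open import Algebra.Bundles using (AbelianGroup; CommutativeRing)
open import Algebra.Bundles.Raw using (RawRing)
import Algebra.Consequences.Setoid
import Algebra.Construct.DirectProduct as Product
import Algebra.Definitions
import Algebra.Definitions.RawSemiring
open import Algebra.Morphism.Structures using (module RingMorphisms)
import Algebra.Properties.CommutativeSemiring.Exp
import Algebra.Properties.Ring
import Algebra.Properties.Semiring.Mult
import Algebra.Properties.Semiring.Mult.TCOptimised
import Algebra.Solver.Ring
import Algebra.Solver.Ring.AlmostCommutativeRing as ACR
open import Data.Fin.Base using (Fin; toℕ; combine; remQuot; inject₁)
open import Data.Fin.Properties using
  ( toℕ-combine; toℕ<n; toℕ-inject₁; toℕ-injective; combine-injective; combine-remQuot
  ; inject₁-injective; injective⇒≤ )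
open import Data.Integer.Base as ℤ using (ℤ; +_; -[1+_]; _⊖_; 0ℤ; 1ℤ)
import Data.Integer.Divisibility.Signed as Signed
import Data.Integer.Properties as ℤ
import Data.Integer.Solver
open import Data.List.Base using
  (List; []; _∷_; _++_; applyUpTo; concatMap; filter; foldr; length; map; replicate)
open import Data.List.Membership.Propositional using (_∈_; find; lose)
open import Data.List.Membership.Propositional.Properties using
  ( ∈-filter⁺; ∈-filter⁻; ∈-applyUpTo⁺; ∈-applyUpTo⁻; ∈-map⁺; ∈-map⁻
  ; ∈-concatMap⁺; ∈-concatMap⁻ )
open import Data.List.Membership.Setoid.Properties using (index-injective)
open import Data.List.Properties using (length-++; length-map; length-replicate; map-++; map-∘)
open import Data.List.Relation.Unary.All as All using (All; []; _∷_)
import Data.List.Relation.Unary.All.Properties as All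
open import Data.List.Relation.Unary.AllPairs as AllPairs using (AllPairs; []; _∷_)
import Data.List.Relation.Unary.AllPairs.Properties as AllPairs
open import Data.List.Relation.Unary.Any as Any using (here; there)
open import Data.List.Relation.Unary.Unique.Propositional using (Unique)
import Data.List.Relation.Unary.Unique.Propositional.Properties as Unique
open import Data.Maybe.Base as Maybe using (Maybe)
open import Data.Nat.Base as ℕ using (ℕ; zero; suc; z≤n; s≤s)
open import Data.Nat.Coprimality as Coprimality using (Coprime)
import Data.Nat.Divisibility as ℕ
import Data.Nat.DivMod as ℕ
open import Data.Nat.GCD using (gcd; gcd[m,n]∣m; gcd[m,n]∣n; gcd-greatest)
open import Data.Nat.Primality using (Prime; euclidsLemma; prime⇒nonTrivial; prime⇒nonZero)
import Data.Nat.Properties as ℕ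
import Data.Nat.Solver
open import Data.Product.Base using (_×_; _,_; ∃₂; proj₁; proj₂)
open import Data.Sum.Base using (_⊎_; inj₁; inj₂; [_,_]′)
open import Function.Base using (id; _∘_)
import Relation.Binary.PropositionalEquality as ≡
open import Relation.Binary.PropositionalEquality using (_≡_; _≢_)
import Relation.Binary.Reasoning.Setoid
open import Relation.Nullary.Construct.Add.Supremum using ([_])
open import Relation.Nullary.Decidable using (dec⇒maybe; no; yes; ¬?; _×-dec_)
open import Relation.Nullary.Negation using (contradiction)
open import Relation.Nullary.Negation.Core using (¬_)

open RingMorphisms using (IsRingHomomorphism)

module ℤSolver = Data.Integer.Solver.+-*-Solver
module ℕSolver = Data.Nat.Solver.+-*-Solver

mkIsRingHomomorphism : ∀ {a b ℓ₁ ℓ₂} {A : RawRing a ℓ₁} {B : RawRing b ℓ₂} →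
  let module A = RawRing A; module B = RawRing B in {f : A.Carrier → B.Carrier} →
  (∀ {x y} → x A.≈ y → f x B.≈ f y) →
  (∀ x y → f (x A.+ y) B.≈ f x B.+ f y) →
  (∀ x y → f (x A.* y) B.≈ f x B.* f y) →
  (∀ x → f (A.- x) B.≈ B.- f x) →
  f A.0# B.≈ B.0# → f A.1# B.≈ B.1# → IsRingHomomorphism A B f
mkIsRingHomomorphism cong +-homo *-homo -‿homo 0#-homo 1#-homo = record
  { isSemiringHomomorphism = record
    { isNearSemiringHomomorphism = record
      { +-isMonoidHomomorphism = record
        { isMagmaHomomorphism = record
          { isRelHomomorphism = record { cong = cong }
          ; homo = +-homo
          }
        ; ε-homo = 0#-homo
        }
      ; *-homo = *-homo
      }
    ; 1#-homo = 1#-homo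
    }
  ; -‿homo = -‿homo
  }

-- Ring homomorphisms and evaluation

-- `eval` embeds the integers by `fromℤ`, so its naturality rests on `fromℤ` being a homomorphism.
-- The same fact gives every commutative ring a solver with integer coefficients.
module FromInteger {c ℓ} (R : CommutativeRing c ℓ) where
  open CommutativeRing R
  open Evaluation rawRing using (fromℤ)
  open Algebra.Properties.Ring ring
  open Algebra.Properties.Semiring.Mult semiring using (×-homo-+; ×1-homo-*) renaming (_×_ to _·_)
  open Relation.Binary.Reasoning.Setoid setoid

  private
    fromℤ-neg : ∀ n → fromℤ (ℤ.- (+ n)) ≈ - (n · 1#)
    fromℤ-neg zero    = sym -0#≈0#
    fromℤ-neg (suc n) = refl

    fromℤ-⊖ : ∀ m n → fromℤ (m ⊖ n) ≈ m · 1# + - (n · 1#)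
    fromℤ-⊖ m       zero    = sym (trans (+-congˡ -0#≈0#) (+-identityʳ _))
    fromℤ-⊖ zero    (suc n) = sym (+-identityˡ _)
    fromℤ-⊖ (suc m) (suc n) rewrite ℤ.[1+m]⊖[1+n]≡m⊖n m n = begin
      fromℤ (m ⊖ n)                             ≈⟨ fromℤ-⊖ m n ⟩
      m · 1# + - (n · 1#)                        ≈⟨ +-congʳ (+-identityʳ _) ⟨
      m · 1# + 0# + - (n · 1#)                   ≈⟨ +-congʳ (+-congˡ (-‿inverseʳ 1#)) ⟨
      m · 1# + (1# + - 1#) + - (n · 1#)          ≈⟨ +-congʳ (+-assoc _ _ _) ⟨
      m · 1# + 1# + - 1# + - (n · 1#)            ≈⟨ +-assoc _ _ _ ⟩
      m · 1# + 1# + (- 1# + - (n · 1#))          ≈⟨ +-cong (+-comm _ _) (-‿+-comm _ _) ⟩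
      1# + m · 1# + - (1# + n · 1#)              ∎

    fromℤ-+ : ∀ i j → fromℤ (i ℤ.+ j) ≈ fromℤ i + fromℤ j
    fromℤ-+ (+ m)    (+ n)    = ×-homo-+ 1# m n
    fromℤ-+ (+ m)    -[1+ n ] = fromℤ-⊖ m (suc n)
    fromℤ-+ -[1+ m ] (+ n)    = trans (fromℤ-⊖ n (suc m)) (+-comm _ _)
    fromℤ-+ -[1+ m ] -[1+ n ] = begin
      - ((suc (suc (m ℕ.+ n))) · 1#)          ≡⟨ ≡.cong (λ k → - (suc k · 1#)) (ℕ.+-suc m n) ⟨
      - ((suc m ℕ.+ suc n) · 1#)              ≈⟨ -‿cong (×-homo-+ 1# (suc m) (suc n)) ⟩
      - (suc m · 1# + suc n · 1#)             ≈⟨ -‿+-comm _ _ ⟨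
      - (suc m · 1#) + - (suc n · 1#)         ∎

    fromℤ-* : ∀ i j → fromℤ (i ℤ.* j) ≈ fromℤ i * fromℤ j
    fromℤ-* (+ m) (+ n) rewrite ℤ.+◃n≡+n (m ℕ.* n) = ×1-homo-* m n
    fromℤ-* (+ m) -[1+ n ] rewrite ℤ.-◃n≡-n (m ℕ.* suc n) = begin
      fromℤ (ℤ.- (+ (m ℕ.* suc n)))   ≈⟨ fromℤ-neg (m ℕ.* suc n) ⟩
      - ((m ℕ.* suc n) · 1#)           ≈⟨ -‿cong (×1-homo-* m (suc n)) ⟩
      - (m · 1# * suc n · 1#)          ≈⟨ -‿distribʳ-* _ _ ⟩
      m · 1# * - (suc n · 1#)          ∎
    fromℤ-* -[1+ m ] (+ n) rewrite ℤ.-◃n≡-n (suc m ℕ.* n) = begin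
      fromℤ (ℤ.- (+ (suc m ℕ.* n)))   ≈⟨ fromℤ-neg (suc m ℕ.* n) ⟩
      - ((suc m ℕ.* n) · 1#)           ≈⟨ -‿cong (×1-homo-* (suc m) n) ⟩
      - (suc m · 1# * n · 1#)          ≈⟨ -‿distribˡ-* _ _ ⟩
      - (suc m · 1#) * n · 1#          ∎
    fromℤ-* -[1+ m ] -[1+ n ] rewrite ℤ.+◃n≡+n (suc m ℕ.* suc n) = begin
      (suc m ℕ.* suc n) · 1#             ≈⟨ ×1-homo-* (suc m) (suc n) ⟩
      suc m · 1# * suc n · 1#            ≈⟨ -‿involutive _ ⟨
      - - (suc m · 1# * suc n · 1#)      ≈⟨ -‿cong (-‿distribˡ-* _ _) ⟩
      - (- (suc m · 1#) * suc n · 1#)    ≈⟨ -‿distribʳ-* _ _ ⟩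
      - (suc m · 1#) * - (suc n · 1#)    ∎

    fromℤ-‿- : ∀ i → fromℤ (ℤ.- i) ≈ - fromℤ i
    fromℤ-‿- (+ n)    = fromℤ-neg n
    fromℤ-‿- -[1+ n ] = sym (-‿involutive _)

  fromℤ-isRingHomomorphism : IsRingHomomorphism ℤ.+-*-rawRing rawRing fromℤ
  fromℤ-isRingHomomorphism = mkIsRingHomomorphism
    (λ { ≡.refl → refl }) fromℤ-+ fromℤ-* fromℤ-‿- refl (+-identityʳ 1#)

  private
    module Optimised = Algebra.Properties.Semiring.Mult.TCOptimised semiring

    ⟦_⟧ : ℤ → Carrier
    ⟦ + n ⟧      = n Optimised.× 1#
    ⟦ -[1+ n ] ⟧ = - (suc n Optimised.× 1#)

    ⟦⟧≈fromℤ : ∀ i → ⟦ i ⟧ ≈ fromℤ i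
    ⟦⟧≈fromℤ (+ n)    = sym (Optimised.×ᵤ≈× n 1#)
    ⟦⟧≈fromℤ -[1+ n ] = -‿cong (sym (Optimised.×ᵤ≈× (suc n) 1#))

    homo₂ : (_∙_ : ℤ → ℤ → ℤ) (_∘_ : Carrier → Carrier → Carrier) →
            (∀ {x x′ y y′} → x ≈ x′ → y ≈ y′ → (x ∘ y) ≈ (x′ ∘ y′)) →
            (∀ i j → fromℤ (i ∙ j) ≈ (fromℤ i ∘ fromℤ j)) → ∀ i j → ⟦ i ∙ j ⟧ ≈ (⟦ i ⟧ ∘ ⟦ j ⟧)
    homo₂ _∙_ _ ∘-cong homo i j = trans (⟦⟧≈fromℤ (i ∙ j))
      (trans (homo i j) (∘-cong (sym (⟦⟧≈fromℤ i)) (sym (⟦⟧≈fromℤ j))))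

    -- The type-checking optimised multiples make con (+ 1) mean 1# itself.
    coefficients : ℤ.+-*-rawRing ACR.-Raw-AlmostCommutative⟶ ACR.fromCommutativeRing R
    coefficients = record
      { ⟦_⟧    = ⟦_⟧
      ; +-homo = homo₂ ℤ._+_ _+_ +-cong fromℤ-+
      ; *-homo = homo₂ ℤ._*_ _*_ *-cong fromℤ-*
      ; -‿homo = λ i → trans (⟦⟧≈fromℤ (ℤ.- i)) (trans (fromℤ-‿- i) (-‿cong (sym (⟦⟧≈fromℤ i))))
      ; 0-homo = refl
      ; 1-homo = refl
      }

    coefficients-≟ : ∀ i j → Maybe (⟦ i ⟧ ≈ ⟦ j ⟧)
    coefficients-≟ i j = Maybe.map (λ { ≡.refl → refl }) (dec⇒maybe (i ℤ.≟ j))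

  module Solver =
    Algebra.Solver.Ring ℤ.+-*-rawRing (ACR.fromCommutativeRing R) coefficients coefficients-≟

module _ {a ℓ₁ c ℓ₂} {A : RawRing a ℓ₁} (R : CommutativeRing c ℓ₂) where
  private module A = RawRing A
  open CommutativeRing R
  open Evaluation rawRing
  open Polynomial A using (const; var)
  open Algebra.Properties.Ring ring
  open FromInteger R
  open Solver using (solve; _:=_; _:+_; _:*_; :-_; con)

  module _ {φ : A.Carrier → Carrier} (φ-hom : IsRingHomomorphism A rawRing φ) (x : Carrier) where
    private module φ = IsRingHomomorphism φ-hom
    open Relation.Binary.Reasoning.Setoid setoid

    private
      H = horner φ x

      -- Polynomials are compared coefficient by coefficient, so equal ones may be lists of
      -- different lengths. The surplus coefficients are all zero, and so is their contribution.
      horner-0 : ∀ f → (∀ i → A.0# A.≈ Polynomial.coeff A f i) → 0# ≈ H f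
      horner-0 []      eq = refl
      horner-0 (a ∷ f) eq = begin
        0#                ≈⟨ +-identityʳ 0# ⟨
        0# + 0#           ≈⟨ +-cong (trans (sym φ.0#-homo) (φ.⟦⟧-cong (eq 0))) (sym (zeroʳ x)) ⟩
        φ a + x * 0#      ≈⟨ +-congˡ (*-congˡ (horner-0 f (λ i → eq (suc i)))) ⟩
        φ a + x * H f     ∎

      horner-0′ : ∀ f → (∀ i → Polynomial.coeff A f i A.≈ A.0#) → H f ≈ 0#
      horner-0′ []      eq = refl
      horner-0′ (a ∷ f) eq = begin
        φ a + x * H f     ≈⟨ +-cong (φ.⟦⟧-cong (eq 0)) (*-congˡ (horner-0′ f (λ i → eq (suc i)))) ⟩
        φ A.0# + x * 0#   ≈⟨ +-cong φ.0#-homo (zeroʳ x) ⟩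
        0# + 0#           ≈⟨ +-identityʳ 0# ⟩
        0#                ∎

      horner-cong : ∀ {f g} → RawRing._≈_ (A [X]) f g → H f ≈ H g
      horner-cong {[]}    {g}     eq = horner-0 g eq
      horner-cong {a ∷ f} {[]}    eq = horner-0′ (a ∷ f) eq
      horner-cong {a ∷ f} {b ∷ g} eq =
        +-cong (φ.⟦⟧-cong (eq 0)) (*-congˡ (horner-cong {f} {g} (λ i → eq (suc i))))

      horner-+ : ∀ f g → H (Polynomial.add A f g) ≈ H f + H g
      horner-+ []      g       = sym (+-identityˡ _)
      horner-+ (a ∷ f) []      = sym (+-identityʳ _)
      horner-+ (a ∷ f) (b ∷ g) = begin
        φ (a A.+ b) + x * H (Polynomial.add A f g)  ≈⟨ +-cong (φ.+-homo a b) (*-congˡ (horner-+ f g)) ⟩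
        φ a + φ b + x * (H f + H g)
          ≈⟨ solve 5 (λ a b x f g → a :+ b :+ x :* (f :+ g) := a :+ x :* f :+ (b :+ x :* g))
               refl (φ a) (φ b) x (H f) (H g) ⟩
        φ a + x * H f + (φ b + x * H g)             ∎

      horner-map-* : ∀ a g → H (map (a A.*_) g) ≈ φ a * H g
      horner-map-* a []      = sym (zeroʳ _)
      horner-map-* a (b ∷ g) = begin
        φ (a A.* b) + x * H (map (a A.*_) g)  ≈⟨ +-cong (φ.*-homo a b) (*-congˡ (horner-map-* a g)) ⟩
        φ a * φ b + x * (φ a * H g)
          ≈⟨ solve 4 (λ a b x g → a :* b :+ x :* (a :* g) := a :* (b :+ x :* g))
               refl (φ a) (φ b) x (H g) ⟩
        φ a * (φ b + x * H g)                 ∎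

      horner-* : ∀ f g → H (Polynomial.mul A f g) ≈ H f * H g
      horner-* []      g = sym (zeroˡ _)
      horner-* (a ∷ f) g = begin
        H (Polynomial.add A (map (a A.*_) g) (A.0# ∷ Polynomial.mul A f g))
          ≈⟨ horner-+ (map (a A.*_) g) _ ⟩
        H (map (a A.*_) g) + (φ A.0# + x * H (Polynomial.mul A f g))
          ≈⟨ +-cong (horner-map-* a g) (+-cong φ.0#-homo (*-congˡ (horner-* f g))) ⟩
        φ a * H g + (0# + x * (H f * H g))
          ≈⟨ solve 4 (λ a f x g → a :* g :+ (con (+ 0) :+ x :* (f :* g)) := (a :+ x :* f) :* g)
               refl (φ a) (H f) x (H g) ⟩
        (φ a + x * H f) * H g ∎

      horner-‿- : ∀ f → H (map A.-_ f) ≈ - H f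
      horner-‿- []      = sym -0#≈0#
      horner-‿- (a ∷ f) = begin
        φ (A.- a) + x * H (map A.-_ f)  ≈⟨ +-cong (φ.-‿homo a) (*-congˡ (horner-‿- f)) ⟩
        - φ a + x * - H f
          ≈⟨ solve 3 (λ a x f → :- a :+ x :* :- f := :- (a :+ x :* f)) refl (φ a) x (H f) ⟩
        - (φ a + x * H f)               ∎

    horner-const : ∀ a → H (const a) ≈ φ a
    horner-const a = trans (+-congˡ (zeroʳ x)) (+-identityʳ _)

    horner-var : H var ≈ x
    horner-var = begin
      φ A.0# + x * (φ A.1# + x * 0#)  ≈⟨ +-cong φ.0#-homo (*-congˡ (horner-const A.1#)) ⟩
      0# + x * φ A.1#                 ≈⟨ +-identityˡ _ ⟩
      x * φ A.1#                      ≈⟨ *-congˡ φ.1#-homo ⟩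
      x * 1#                          ≈⟨ *-identityʳ x ⟩
      x                               ∎

    -- The coefficients form only a raw ring, so the result applies again with `A [X]` in place of
    -- `A`: this is how evaluation in two variables is obtained.
    horner-isRingHomomorphism : IsRingHomomorphism (A [X]) rawRing H
    horner-isRingHomomorphism = mkIsRingHomomorphism
      (λ {f} {g} → horner-cong {f} {g}) horner-+ horner-* horner-‿- refl
      (trans (horner-const A.1#) φ.1#-homo)

  module _ {h : A.Carrier → Carrier} (h-hom : IsRingHomomorphism A rawRing h) where
    private
      module h = IsRingHomomorphism h-hom
      module EA = Evaluation A
      open Algebra.Definitions.RawSemiring A.rawSemiring renaming (_×_ to _×ᴬ_)
      open Algebra.Definitions.RawSemiring (RawRing.rawSemiring rawRing) renaming (_×_ to _×ᴿ_)

      ×1-natural : ∀ n → h (n ×ᴬ A.1#) ≈ n ×ᴿ 1#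
      ×1-natural zero    = h.0#-homo
      ×1-natural (suc n) = trans (h.+-homo _ _) (+-cong h.1#-homo (×1-natural n))

    fromℤ-natural : ∀ i → h (EA.fromℤ i) ≈ fromℤ i
    fromℤ-natural (+ n)    = ×1-natural n
    fromℤ-natural -[1+ n ] = trans (h.-‿homo _) (-‿cong (×1-natural (suc n)))

    horner-natural : ∀ {b} {B : Set b} {φ : B → A.Carrier} {ψ : B → Carrier} →
      (∀ y → h (φ y) ≈ ψ y) → ∀ {x x′} → h x ≈ x′ →
      ∀ f → h (EA.horner φ x f) ≈ horner ψ x′ f
    horner-natural eq eqx []      = h.0#-homo
    horner-natural eq eqx (b ∷ f) = trans (h.+-homo _ _) (+-cong (eq b)
      (trans (h.*-homo _ _) (*-cong eqx (horner-natural eq eqx f))))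

    -- This carries the defining identity of the atoms over to integer values. It is applied to
    -- `fromℤ` on the integers and to the substitution of two roots for `α` and `β`.
    eval-natural : ∀ P {a a′ b b′} → h a ≈ a′ → h b ≈ b′ →
      h (EA.eval P a b) ≈ eval P a′ b′
    eval-natural P eqa eqb = horner-natural (horner-natural fromℤ-natural eqa) eqb P

-- Pairs (a , b) stand for a + b x in A[x] / (x² − s x − t).

module QuadraticExtension {c ℓ} (A : CommutativeRing c ℓ) (s t : CommutativeRing.Carrier A) where
  private
    module A = CommutativeRing A
    open A using (_+_; _*_; 0#; 1#)
    open FromInteger.Solver A using (solve; _:=_; _:+_; _:*_; con)

    infixl 7 _⊛_
    _⊛_ : A.Carrier × A.Carrier → A.Carrier × A.Carrier → A.Carrier × A.Carrier
    (a , b) ⊛ (c , d) = a * c + t * (b * d) , a * d + b * c + s * (b * d)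

  commutativeRing : CommutativeRing c ℓ
  commutativeRing = record
    { _*_ = _⊛_
    ; 1#  = 1# , 0#
    ; isCommutativeRing = record
      { isRing = record
        { +-isAbelianGroup = G.isAbelianGroup
        ; *-cong = λ (p , q) (p′ , q′) →
            A.+-cong (A.*-cong p p′) (A.*-congˡ (A.*-cong q q′)) ,
            A.+-cong (A.+-cong (A.*-cong p q′) (A.*-cong q p′)) (A.*-congˡ (A.*-cong q q′))
        ; *-assoc = λ (a , b) (c , d) (e , f) →
            solve 8 (λ s t a b c d e f →
              (a :* c :+ t :* (b :* d)) :* e :+ t :* ((a :* d :+ b :* c :+ s :* (b :* d)) :* f)
              := a :* (c :* e :+ t :* (d :* f)) :+ t :* (b :* (c :* f :+ d :* e :+ s :* (d :* f))))
              A.refl s t a b c d e f ,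
            solve 8 (λ s t a b c d e f →
              (a :* c :+ t :* (b :* d)) :* f :+ (a :* d :+ b :* c :+ s :* (b :* d)) :* e
                :+ s :* ((a :* d :+ b :* c :+ s :* (b :* d)) :* f)
              := a :* (c :* f :+ d :* e :+ s :* (d :* f)) :+ b :* (c :* e :+ t :* (d :* f))
                :+ s :* (b :* (c :* f :+ d :* e :+ s :* (d :* f))))
              A.refl s t a b c d e f
        ; *-identity = comm∧idˡ⇒id ⊛-comm ⊛-identityˡ
        ; distrib = comm∧distrˡ⇒distr G.∙-cong ⊛-comm ⊛-distribˡ
        }
      ; *-comm = ⊛-comm
      }
    }
    where
    module G = AbelianGroup (Product.abelianGroup A.+-abelianGroup A.+-abelianGroup)
    open Algebra.Consequences.Setoid G.setoid using (comm∧idˡ⇒id; comm∧distrˡ⇒distr)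
    open Algebra.Definitions G._≈_

    ⊛-comm : Commutative _⊛_
    ⊛-comm (a , b) (c , d) =
      solve 5 (λ t a b c d → a :* c :+ t :* (b :* d) := c :* a :+ t :* (d :* b)) A.refl t a b c d ,
      solve 5 (λ s a b c d → a :* d :+ b :* c :+ s :* (b :* d) := c :* b :+ d :* a :+ s :* (d :* b))
        A.refl s a b c d

    ⊛-identityˡ : LeftIdentity (1# , 0#) _⊛_
    ⊛-identityˡ (a , b) =
      solve 3 (λ t a b → con (+ 1) :* a :+ t :* (con (+ 0) :* b) := a) A.refl t a b ,
      solve 3 (λ s a b → con (+ 1) :* b :+ con (+ 0) :* a :+ s :* (con (+ 0) :* b) := b) A.refl s a b

    ⊛-distribˡ : _⊛_ DistributesOverˡ G._∙_
    ⊛-distribˡ (a , b) (c , d) (e , f) =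
      solve 7 (λ t a b c d e f → a :* (c :+ e) :+ t :* (b :* (d :+ f))
        := (a :* c :+ t :* (b :* d)) :+ (a :* e :+ t :* (b :* f))) A.refl t a b c d e f ,
      solve 7 (λ s a b c d e f → a :* (d :+ f) :+ b :* (c :+ e) :+ s :* (b :* (d :+ f))
        := (a :* d :+ b :* c :+ s :* (b :* d)) :+ (a :* f :+ b :* e :+ s :* (b :* f))) A.refl s a b c d e f

  private module R = CommutativeRing commutativeRing

  ι : A.Carrier → R.Carrier
  ι a = a , 0#

  ι-isRingHomomorphism : IsRingHomomorphism A.rawRing R.rawRing ι
  ι-isRingHomomorphism = mkIsRingHomomorphism
    (λ eq → eq , A.refl)
    (λ a b → A.refl , A.sym (A.+-identityʳ 0#))
    (λ a b →
      solve 3 (λ t a b → a :* b := a :* b :+ t :* (con (+ 0) :* con (+ 0))) A.refl t a b ,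
      solve 3 (λ s a b → con (+ 0) := a :* con (+ 0) :+ con (+ 0) :* b :+ s :* (con (+ 0) :* con (+ 0)))
        A.refl s a b)
    (λ a → A.refl , A.sym (Algebra.Properties.Ring.-0#≈0# A.ring))
    (A.refl , A.refl) (A.refl , A.refl)

  x : R.Carrier
  x = 0# , 1#

  x²≈sx+t : x R.* x R.≈ ι s R.* x R.+ ι t
  x²≈sx+t =
    solve 2 (λ s t → con (+ 0) :* con (+ 0) :+ t :* (con (+ 1) :* con (+ 1))
      := s :* con (+ 0) :+ t :* (con (+ 0) :* con (+ 1)) :+ t) A.refl s t ,
    solve 1 (λ s → con (+ 0) :* con (+ 1) :+ con (+ 1) :* con (+ 0) :+ s :* (con (+ 1) :* con (+ 1))
      := s :* con (+ 1) :+ con (+ 0) :* con (+ 0) :+ s :* (con (+ 0) :* con (+ 1)) :+ con (+ 0)) A.refl s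

-- Binary forms and their zeros

module GeometricSum {c ℓ} (R : CommutativeRing c ℓ) where
  open CommutativeRing R
  open Evaluation rawRing using (fromℤ)
  open Algebra.Properties.CommutativeSemiring.Exp commutativeSemiring
  open FromInteger R
  open Solver using (solve; _:=_; _:+_; _:*_; :-_; con)
  open Relation.Binary.Reasoning.Setoid setoid

  -- The sum of aⁱ bʲ over i + j = m, which has m + 1 terms: a form of (a^{m+1} - b^{m+1}) / (a - b)
  -- without the division.
  geometricSum : Carrier → Carrier → ℕ → Carrier
  geometricSum a b zero    = 1#
  geometricSum a b (suc m) = a ^ suc m + b * geometricSum a b m

  geometricSum-cong : ∀ {a a′ b b′} → a ≈ a′ → b ≈ b′ → ∀ m → geometricSum a b m ≈ geometricSum a′ b′ m
  geometricSum-cong p q zero    = refl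
  geometricSum-cong p q (suc m) = +-cong (^-congˡ (suc m) p) (*-cong q (geometricSum-cong p q m))

  geometricSum-telescopes : ∀ a b m →
    (a + - b) * geometricSum a b m ≈ a ^ suc m + - (b ^ suc m)
  geometricSum-telescopes a b zero    =
    solve 2 (λ a b → (a :+ :- b) :* con (+ 1) := a :* con (+ 1) :+ :- (b :* con (+ 1))) refl a b
  geometricSum-telescopes a b (suc m) = begin
    (a + - b) * (a ^ suc m + b * geometricSum a b m)
      ≈⟨ solve 4 (λ a b u g → (a :+ :- b) :* (u :+ b :* g) := (a :+ :- b) :* u :+ b :* ((a :+ :- b) :* g))
           refl a b (a ^ suc m) (geometricSum a b m) ⟩
    (a + - b) * a ^ suc m + b * ((a + - b) * geometricSum a b m)
      ≈⟨ +-congˡ (*-congˡ (geometricSum-telescopes a b m)) ⟩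
    (a + - b) * a ^ suc m + b * (a ^ suc m + - (b ^ suc m))
      ≈⟨ solve 4 (λ a b u v → (a :+ :- b) :* u :+ b :* (u :+ :- v) := a :* u :+ :- (b :* v))
           refl a b (a ^ suc m) (b ^ suc m) ⟩
    a ^ suc (suc m) + - (b ^ suc (suc m)) ∎

  geometricSum-recurrence : ∀ a b m → geometricSum a b (suc (suc m)) ≈
    (a + b) * geometricSum a b (suc m) + - (a * b) * geometricSum a b m
  geometricSum-recurrence a b m =
    solve 4 (λ a b u g → a :* u :+ b :* (u :+ b :* g) := (a :+ b) :* (u :+ b :* g) :+ :- (a :* b) :* g)
      refl a b (a ^ suc m) (geometricSum a b m)

  -- Both sides obey the same recurrence of order two, so the induction carries two consecutive
  -- values. Nothing is divided by a - b, and a double root is covered too.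
  geometricSum-lucas : ∀ {a b} S T → a + b ≈ fromℤ S → - (a * b) ≈ fromℤ T →
    ∀ m → geometricSum a b m ≈ fromℤ (U S T (suc m))
  geometricSum-lucas {a} {b} S T a+b -ab = λ m → proj₁ (both m)
    where
    module fromℤ = IsRingHomomorphism fromℤ-isRingHomomorphism

    both : ∀ m → geometricSum a b m ≈ fromℤ (U S T (suc m)) ×
                 geometricSum a b (suc m) ≈ fromℤ (U S T (suc (suc m)))
    both zero = sym fromℤ.1#-homo , (begin
      a * 1# + b * 1#                            ≈⟨ +-cong (*-identityʳ a) (*-identityʳ b) ⟩
      a + b                                      ≈⟨ a+b ⟩
      fromℤ S                                    ≡⟨ ≡.cong fromℤ (ℤ.*-identityʳ S) ⟨
      fromℤ (S ℤ.* ℤ.1ℤ)                         ≡⟨ ≡.cong fromℤ (ℤ.+-identityʳ (S ℤ.* ℤ.1ℤ)) ⟨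
      fromℤ (S ℤ.* ℤ.1ℤ ℤ.+ ℤ.0ℤ)                ≡⟨ ≡.cong (λ z → fromℤ (S ℤ.* ℤ.1ℤ ℤ.+ z)) (ℤ.*-zeroʳ T) ⟨
      fromℤ (S ℤ.* ℤ.1ℤ ℤ.+ T ℤ.* ℤ.0ℤ)          ∎)
    both (suc m) with p , q ← both m = q , (begin
      geometricSum a b (suc (suc m))
        ≈⟨ geometricSum-recurrence a b m ⟩
      (a + b) * geometricSum a b (suc m) + - (a * b) * geometricSum a b m
        ≈⟨ +-cong (*-cong a+b q) (*-cong -ab p) ⟩
      fromℤ S * fromℤ (U S T (suc (suc m))) + fromℤ T * fromℤ (U S T (suc m))
        ≈⟨ +-cong (fromℤ.*-homo S _) (fromℤ.*-homo T _) ⟨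
      fromℤ (S ℤ.* U S T (suc (suc m))) + fromℤ (T ℤ.* U S T (suc m))
        ≈⟨ fromℤ.+-homo (S ℤ.* U S T (suc (suc m))) (T ℤ.* U S T (suc m)) ⟨
      fromℤ (U S T (suc (suc (suc m)))) ∎)

-- A list a₀ ∷ … ∷ aₘ ∷ [] is read as the binary form a₀xᵐ + a₁xᵐ⁻¹y + ⋯ + aₘyᵐ.

module BinaryForm {a ℓ} (K : CommutativeRing a ℓ) where
  private module K = CommutativeRing K

  -- Horner's scheme for dividing `b ∷ as` by x - r y. The leading coefficient is kept apart, so
  -- that the quotient has exactly the length of `as`.
  quotient : K.Carrier → K.Carrier → List K.Carrier → List K.Carrier
  quotient r b []       = []
  quotient r b (a ∷ as) = b ∷ quotient r (a K.+ r K.* b) as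

  remainder : K.Carrier → K.Carrier → List K.Carrier → K.Carrier
  remainder r b []       = b
  remainder r b (a ∷ as) = remainder r (a K.+ r K.* b) as

  length-quotient : ∀ r b as → length (quotient r b as) ≡ length as
  length-quotient r b []       = ≡.refl
  length-quotient r b (a ∷ as) = ≡.cong suc (length-quotient r _ as)

  -- 1 ∷ geometricTail N m lists the coefficients of Σ_{i ≤ m} x^{(N+1)i}.

  geometricTail : ℕ → ℕ → List K.Carrier
  geometricTail N zero    = []
  geometricTail N (suc m) = replicate N K.0# ++ K.1# ∷ geometricTail N m

  length-geometricTail : ∀ N m → length (geometricTail N m) ≡ m ℕ.* suc N
  length-geometricTail N zero    = ≡.refl
  length-geometricTail N (suc m) = ≡.trans (length-++ (replicate N K.0#))
    (≡.trans (≡.cong₂ ℕ._+_ (length-replicate N) (≡.cong suc (length-geometricTail N m)))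
      (ℕ.+-suc N (m ℕ.* suc N)))

  -- Two instances matter. With R = K and y = 1 the form is a polynomial whose zeros can be counted;
  -- with R the quadratic extension it is evaluated at the two roots of x² - s x - t.
  module Value {c ℓ₂} (R : CommutativeRing c ℓ₂) {φ : K.Carrier → CommutativeRing.Carrier R}
    (φ-hom : IsRingHomomorphism K.rawRing (CommutativeRing.rawRing R) φ)
    (x y : CommutativeRing.Carrier R) where

    private module φ = IsRingHomomorphism φ-hom
    open CommutativeRing R
    open Algebra.Properties.CommutativeSemiring.Exp commutativeSemiring
    open FromInteger.Solver R using (solve; _:=_; _:+_; _:*_; :-_; con)
    open GeometricSum R
    open Relation.Binary.Reasoning.Setoid setoid

    form : List K.Carrier → Carrier
    form []       = 0#
    form (a ∷ as) = φ a * x ^ length as + y * form as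

    linear : K.Carrier → Carrier
    linear r = x + - (φ r * y)

    form-constant : ∀ b → form (b ∷ []) ≈ φ b
    form-constant b = solve 2 (λ b y → b :* con (+ 1) :+ y :* con (+ 0) := b) refl (φ b) y

    -- The homogeneous version of division by x - r: the remainder takes the power of y that
    -- restores the degree.
    form-division : ∀ r b as → form (b ∷ as) ≈
      linear r * form (quotient r b as) + φ (remainder r b as) * y ^ length as
    form-division r b []       =
      solve 3 (λ l y b → b :* con (+ 1) :+ y :* con (+ 0) := l :* con (+ 0) :+ b :* con (+ 1))
        refl (linear r) y (φ b)
    form-division r b (a ∷ as) = begin
      φ b * x ^ suc (length as) + y * (φ a * x ^ length as + y * form as)
        ≈⟨ solve 7 (λ x y r b a u f →
             b :* (x :* u) :+ y :* (a :* u :+ y :* f)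
             := (x :+ :- (r :* y)) :* (b :* u) :+ y :* ((a :+ r :* b) :* u :+ y :* f))
           refl x y (φ r) (φ b) (φ a) (x ^ length as) (form as) ⟩
      linear r * (φ b * x ^ length as) + y * ((φ a + φ r * φ b) * x ^ length as + y * form as)
        ≈⟨ +-congˡ (*-congˡ (+-congʳ (*-congʳ (trans (φ.+-homo a (r K.* b)) (+-congˡ (φ.*-homo r b)))))) ⟨
      linear r * (φ b * x ^ length as) + y * form (b′ ∷ as)
        ≈⟨ +-congˡ (*-congˡ (form-division r b′ as)) ⟩
      linear r * (φ b * x ^ length as) + y * (linear r * form q + φ rem * y ^ length as)
        ≈⟨ solve 6 (λ l u y q v d → l :* u :+ y :* (l :* q :+ d :* v) := l :* (u :+ y :* q) :+ d :* (y :* v))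
             refl (linear r) (φ b * x ^ length as) y (form q) (y ^ length as) (φ rem) ⟩
      linear r * (φ b * x ^ length as + y * form q) + φ rem * y ^ suc (length as)
        ≡⟨ ≡.cong (λ k → linear r * (φ b * x ^ k + y * form q) + φ rem * y ^ suc (length as))
             (length-quotient r b′ as) ⟨
      linear r * form (b ∷ q) + φ rem * y ^ suc (length as) ∎
      where
      b′  = a K.+ r K.* b
      q   = quotient r b′ as
      rem = remainder r b′ as

    form-replicate : ∀ k as → form (replicate k K.0# ++ as) ≈ y ^ k * form as
    form-replicate zero    as = sym (*-identityˡ _)
    form-replicate (suc k) as = begin
      φ K.0# * u + y * form (replicate k K.0# ++ as)
        ≈⟨ +-cong (*-congʳ φ.0#-homo) (*-congˡ (form-replicate k as)) ⟩
      0# * u + y * (y ^ k * form as)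
        ≈⟨ solve 4 (λ u y v f → con (+ 0) :* u :+ y :* (v :* f) := y :* v :* f) refl u y (y ^ k) (form as) ⟩
      y ^ suc k * form as ∎
      where u = x ^ length (replicate k K.0# ++ as)

    form-geometric : ∀ N m →
      form (K.1# ∷ geometricTail N m) ≈ geometricSum (x ^ suc N) (y ^ suc N) m
    form-geometric N zero    = trans (form-constant K.1#) φ.1#-homo
    form-geometric N (suc m) = +-cong
      (begin
        φ K.1# * x ^ length (geometricTail N (suc m))
          ≡⟨ ≡.cong (λ k → φ K.1# * x ^ k) (length-geometricTail N (suc m)) ⟩
        φ K.1# * x ^ (suc m ℕ.* suc N)
          ≈⟨ *-cong φ.1#-homo (^-congʳ x (ℕ.*-comm (suc m) (suc N))) ⟩
        1# * x ^ (suc N ℕ.* suc m)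
          ≈⟨ *-identityˡ _ ⟩
        x ^ (suc N ℕ.* suc m)
          ≈⟨ ^-assocʳ x (suc N) (suc m) ⟨
        (x ^ suc N) ^ suc m ∎)
      (begin
        y * form (replicate N K.0# ++ K.1# ∷ geometricTail N m)
          ≈⟨ *-congˡ (form-replicate N _) ⟩
        y * (y ^ N * form (K.1# ∷ geometricTail N m))
          ≈⟨ *-assoc y (y ^ N) _ ⟨
        y ^ suc N * form (K.1# ∷ geometricTail N m)
          ≈⟨ *-congˡ (form-geometric N m) ⟩
        y ^ suc N * geometricSum (x ^ suc N) (y ^ suc N) m ∎)

module Factorisation {a ℓ} (K : DomainWithRootsOfUnity a ℓ) where
  private module K = DomainWithRootsOfUnity K
  open BinaryForm K.commutativeRing
  open FromInteger.Solver K.commutativeRing using (solve; _:=_; _:+_; _:*_; :-_; con)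
  open Algebra.Properties.Ring K.ring using (x∙y⁻¹≈ε⇒x≈y)

  id-isRingHomomorphism : IsRingHomomorphism K.rawRing K.rawRing id
  id-isRingHomomorphism =
    mkIsRingHomomorphism id (λ _ _ → K.refl) (λ _ _ → K.refl) (λ _ → K.refl) K.refl K.refl

  value : K.Carrier → List K.Carrier → K.Carrier
  value r = Value.form K.commutativeRing id-isRingHomomorphism r K.1#

  *-cancelˡ-≈0 : ∀ {x y} → ¬ x K.≈ K.0# → x K.* y K.≈ K.0# → y K.≈ K.0#
  *-cancelˡ-≈0 {x} {y} x≉0 xy≈0 = K.*-cancelˡ-nonZero x y K.0# x≉0 (K.trans xy≈0 (K.sym (K.zeroʳ x)))

  1^n≈1 : ∀ n → K.1# K.^ n K.≈ K.1#
  1^n≈1 zero    = K.refl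
  1^n≈1 (suc n) = K.trans (K.*-identityˡ _) (1^n≈1 n)

  private module _ where
    open Relation.Binary.Reasoning.Setoid K.setoid

    value-division : ∀ r r′ b as → value r′ (b ∷ as) K.≈
      (r′ K.+ K.- r) K.* value r′ (quotient r b as) K.+ remainder r b as
    value-division r r′ b as = begin
      value r′ (b ∷ as)
        ≈⟨ Value.form-division K.commutativeRing id-isRingHomomorphism r′ K.1# r b as ⟩
      (r′ K.+ K.- (r K.* K.1#)) K.* value r′ (quotient r b as) K.+ remainder r b as K.* K.1# K.^ length as
        ≈⟨ K.+-congˡ (K.*-congˡ (1^n≈1 (length as))) ⟩
      (r′ K.+ K.- (r K.* K.1#)) K.* value r′ (quotient r b as) K.+ remainder r b as K.* K.1#
        ≈⟨ solve 4 (λ r′ r q d → (r′ :+ :- (r :* con (+ 1))) :* q :+ d :* con (+ 1) := (r′ :+ :- r) :* q :+ d)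
             K.refl r′ r _ _ ⟩
      (r′ K.+ K.- r) K.* value r′ (quotient r b as) K.+ remainder r b as ∎

    remainder≈0 : ∀ r b as → value r (b ∷ as) K.≈ K.0# → remainder r b as K.≈ K.0#
    remainder≈0 r b as root = begin
      remainder r b as
        ≈⟨ solve 3 (λ r q d → d := (r :+ :- r) :* q :+ d) K.refl r _ _ ⟩
      (r K.+ K.- r) K.* value r (quotient r b as) K.+ remainder r b as
        ≈⟨ value-division r r b as ⟨
      value r (b ∷ as)
        ≈⟨ root ⟩
      K.0# ∎

    -- With zero remainder the value at r′ is r′ - r times that of the quotient, and r′ - r can be
    -- cancelled in `K`.
    quotient-root : ∀ {r r′} b as → ¬ r K.≈ r′ → remainder r b as K.≈ K.0# →
      value r′ (b ∷ as) K.≈ K.0# → value r′ (quotient r b as) K.≈ K.0#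
    quotient-root {r} {r′} b as r≉r′ rem≈0 root =
      *-cancelˡ-≈0 (r≉r′ ∘ K.sym ∘ x∙y⁻¹≈ε⇒x≈y r′ r) (begin
        (r′ K.+ K.- r) K.* value r′ (quotient r b as)
          ≈⟨ K.+-identityʳ _ ⟨
        (r′ K.+ K.- r) K.* value r′ (quotient r b as) K.+ K.0#
          ≈⟨ K.+-congˡ rem≈0 ⟨
        (r′ K.+ K.- r) K.* value r′ (quotient r b as) K.+ remainder r b as
          ≈⟨ value-division r r′ b as ⟨
        value r′ (b ∷ as)
          ≈⟨ root ⟩
        K.0# ∎)

  module _ {c ℓ₂} (R : CommutativeRing c ℓ₂) {φ : K.Carrier → CommutativeRing.Carrier R}
    (φ-hom : IsRingHomomorphism K.rawRing (CommutativeRing.rawRing R) φ)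
    (x y : CommutativeRing.Carrier R) where

    private
      module R where
        open CommutativeRing R public
        open Algebra.Properties.CommutativeSemiring.Exp commutativeSemiring public using (_^_)
      module φ = IsRingHomomorphism φ-hom
      module RS = FromInteger.Solver R
    open Value R φ-hom x y using (form; linear; form-division; form-constant)

    linearProduct : List K.Carrier → R.Carrier
    linearProduct = foldr (λ r z → linear r R.* z) R.1#

    -- Zeros are split off one at a time. All cancelling happens in `K`, while the identity obtained
    -- holds in R, which may have zero divisors. It suffices that there are at least as many
    -- distinct zeros as the degree.
    factorisation : ∀ rs b as → ¬ b K.≈ K.0# → AllPairs (λ r r′ → ¬ r K.≈ r′) rs →
      All (λ r → value r (b ∷ as) K.≈ K.0#) rs → length as ℕ.≤ length rs →
      form (b ∷ as) R.≈ φ b R.* linearProduct rs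
    factorisation []       b []       b≉0 distinct roots len =
      R.trans (form-constant b) (R.sym (R.*-identityʳ _))
    -- A zero left over when only a constant remains would make the leading coefficient vanish.
    factorisation (r ∷ rs) b []       b≉0 distinct (root ∷ roots) len = contradiction
      (K.trans (K.sym (Value.form-constant K.commutativeRing id-isRingHomomorphism r K.1# b)) root) b≉0
    factorisation (r ∷ rs) b (a ∷ as) b≉0 (r∉rs ∷ distinct) (root ∷ roots) (s≤s len) = begin
      form (b ∷ a ∷ as)
        ≈⟨ form-division r b (a ∷ as) ⟩
      linear r R.* form (b ∷ q) R.+ φ rem R.* u
        ≈⟨ R.+-cong (R.*-congˡ ih) (R.*-congʳ (R.trans (φ.⟦⟧-cong rem≈0) φ.0#-homo)) ⟩
      linear r R.* (φ b R.* linearProduct rs) R.+ R.0# R.* u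
        ≈⟨ RS.solve 4 (λ l b p u → l RS.:* (b RS.:* p) RS.:+ RS.con (+ 0) RS.:* u RS.:= b RS.:* (l RS.:* p))
             R.refl (linear r) (φ b) (linearProduct rs) u ⟩
      φ b R.* (linear r R.* linearProduct rs) ∎
      where
      open Relation.Binary.Reasoning.Setoid R.setoid
      u     = y R.^ length (a ∷ as)
      q     = quotient r (a K.+ r K.* b) as
      rem   = remainder r b (a ∷ as)
      rem≈0 = remainder≈0 r b (a ∷ as) root
      ih    = factorisation rs b q b≉0 distinct
        (All.zipWith (λ (r≉r′ , root′) → quotient-root b (a ∷ as) r≉r′ rem≈0 root′) (r∉rs , roots))
        (ℕ.≤-trans (ℕ.≤-reflexive (length-quotient r _ as)) len)

-- Roots of unity

-- When N divides n, the primitive d-th roots of unity for these d are the zeros of (xⁿ - 1) / (x^N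
-- - 1).
newDivisors : ℕ → ℕ → List ℕ
newDivisors N n = filter (λ d → (d ℕ.∣? n) ×-dec ¬? (d ℕ.∣? N)) (applyUpTo suc n)

newDivisors-unique : ∀ N n → Unique (newDivisors N n)
newDivisors-unique N n = Unique.filter⁺ _
  (AllPairs.applyUpTo⁺₁ suc n (λ i<j _ eq → ℕ.<⇒≢ i<j (ℕ.suc-injective eq)))

∈-newDivisors⁺ : ∀ {N n d} → 1 ℕ.≤ d → 1 ℕ.≤ n → d ℕ.∣ n → ¬ d ℕ.∣ N → d ∈ newDivisors N n
∈-newDivisors⁺ {N} {n@(suc _)} (s≤s z≤n) (s≤s _) d∣n d∤N =
  ∈-filter⁺ (λ d → (d ℕ.∣? n) ×-dec ¬? (d ℕ.∣? N)) (∈-applyUpTo⁺ suc (ℕ.∣⇒≤ d∣n)) (d∣n , d∤N)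

∈-newDivisors⁻ : ∀ {N n d} → d ∈ newDivisors N n → 1 ℕ.≤ d × d ℕ.∣ n × ¬ d ℕ.∣ N
∈-newDivisors⁻ {N} {n} d∈ with ∈-filter⁻ (λ d → (d ℕ.∣? n) ×-dec ¬? (d ℕ.∣? N)) {xs = applyUpTo suc n} d∈
... | d∈′ , d∣n , d∤N with _ , _ , ≡.refl ← ∈-applyUpTo⁻ suc d∈′ = s≤s z≤n , d∣n , d∤N

-- Here j / n = e / d after division by the gcd g. A common divisor x of e and d makes x g a common
-- divisor of j and n, whence x = 1.
lowestTerms : ∀ j n → 1 ℕ.≤ j → 1 ℕ.≤ n →
  ∃₂ λ d e → 1 ℕ.≤ d × 1 ℕ.≤ e × d ℕ.∣ n × Coprime e d × e ℕ.* n ≡ j ℕ.* d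
lowestTerms j n 1≤j 1≤n with gcd j n in eq | gcd[m,n]∣m j n | gcd[m,n]∣n j n
... | zero  | _ | ℕ.divides d n≡dg =
  contradiction (≡.trans n≡dg (ℕ.*-zeroʳ d)) (ℕ.m<n⇒n≢0 1≤n)
... | g@(suc _) | ℕ.divides e j≡eg | ℕ.divides d n≡dg =
  d , e , ℕ.n≢0⇒n>0 (λ { ≡.refl → ℕ.m<n⇒n≢0 1≤n n≡dg }) ,
  ℕ.n≢0⇒n>0 (λ { ≡.refl → ℕ.m<n⇒n≢0 1≤j j≡eg }) ,
  ℕ.divides g n≡gd , coprime , (begin
    e ℕ.* n            ≡⟨ ≡.cong (e ℕ.*_) n≡gd ⟩
    e ℕ.* (g ℕ.* d)    ≡⟨ ℕ.*-assoc e g d ⟨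
    e ℕ.* g ℕ.* d      ≡⟨ ≡.cong (ℕ._* d) j≡eg ⟨
    j ℕ.* d            ∎)
  where
  open ≡.≡-Reasoning
  n≡gd : n ≡ g ℕ.* d
  n≡gd = ≡.trans n≡dg (ℕ.*-comm d g)
  coprime : Coprime e d
  coprime {x} (x∣e , x∣d) = ℕ.∣1⇒≡1 (ℕ.*-cancelʳ-∣ g
    (≡.subst (x ℕ.* g ℕ.∣_) (≡.trans eq (≡.sym (ℕ.*-identityˡ g))) (gcd-greatest
      (≡.subst (x ℕ.* g ℕ.∣_) (≡.sym j≡eg) (ℕ.*-monoˡ-∣ g x∣e))
      (≡.subst (x ℕ.* g ℕ.∣_) (≡.sym n≡dg) (ℕ.*-monoˡ-∣ g x∣d)))))

-- Enumerates the integers in [1, N(m+1)] that m + 1 does not divide.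

nonMultiple : ∀ N m → Fin (N ℕ.* m) → ℕ
-- The value is q(m + 1) + r + 1 with r < m, so its residue modulo m + 1 lies between 1 and m.
nonMultiple N m i = let q , r = remQuot {N} m i in suc (toℕ (combine q (inject₁ r)))

nonMultiple-injective : ∀ N m {i j} → nonMultiple N m i ≡ nonMultiple N m j → i ≡ j
nonMultiple-injective N m {i} {j} eq
  with q≡q′ , r≡r′ ← combine-injective
    (proj₁ (remQuot {N} m i)) (inject₁ (proj₂ (remQuot {N} m i)))
    (proj₁ (remQuot {N} m j)) (inject₁ (proj₂ (remQuot {N} m j))) (toℕ-injective (ℕ.suc-injective eq)) =
  ≡.trans (≡.sym (combine-remQuot {N} m i)) (≡.trans
    (≡.cong₂ (combine {N}) q≡q′ (inject₁-injective r≡r′)) (combine-remQuot {N} m j))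

nonMultiple-≤ : ∀ N m i → nonMultiple N m i ℕ.≤ N ℕ.* suc m
nonMultiple-≤ N m i = toℕ<n _

nonMultiple-∤ : ∀ N m i → ¬ suc m ℕ.∣ nonMultiple N m i
nonMultiple-∤ N m i m∣ =
  ℕ.>⇒∤ (s≤s (toℕ<n r)) (ℕ.∣m+n∣m⇒∣n (≡.subst (suc m ℕ.∣_) eq m∣) (ℕ.m∣m*n (toℕ q)))
  where
  q = proj₁ (remQuot {N} m i)
  r = proj₂ (remQuot {N} m i)
  eq : nonMultiple N m i ≡ suc m ℕ.* toℕ q ℕ.+ suc (toℕ r)
  eq = ≡.trans (≡.cong suc (≡.trans (toℕ-combine q (inject₁ r))
    (≡.cong (suc m ℕ.* toℕ q ℕ.+_) (toℕ-inject₁ r)))) (≡.sym (ℕ.+-suc _ _))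

module RootsOfUnity {a ℓ} (K : DomainWithRootsOfUnity a ℓ) where
  open DomainWithRootsOfUnity K
  open LucasAtoms K using (totatives)
  open Algebra.Properties.CommutativeSemiring.Exp commutativeSemiring
    using (^-homo-*; ^-assocʳ; ^-congˡ)
  open Factorisation K
  open BinaryForm commutativeRing
  open GeometricSum commutativeRing
  open Algebra.Properties.Ring ring using (x≈y⇒x∙y⁻¹≈ε; x∙y⁻¹≈ε⇒x≈y)
  open Relation.Binary.Reasoning.Setoid setoid

  ^-multiple≈1 : ∀ {w d k} → w ^ d ≈ 1# → d ℕ.∣ k → w ^ k ≈ 1#
  ^-multiple≈1 {w} {d} w^d≈1 (ℕ.divides-refl q) = begin
    w ^ (q ℕ.* d)  ≡⟨ ≡.cong (w ^_) (ℕ.*-comm q d) ⟩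
    w ^ (d ℕ.* q)  ≈⟨ ^-assocʳ w d q ⟨
    (w ^ d) ^ q    ≈⟨ ^-congˡ q w^d≈1 ⟩
    1# ^ q         ≈⟨ 1^n≈1 q ⟩
    1#             ∎

  order-divides : ∀ {d w k} → 1 ℕ.≤ d → PrimitiveRoot d w → w ^ k ≈ 1# → d ℕ.∣ k
  order-divides {d@(suc _)} {w} {k} _ (w^d≈1 , minimal) w^k≈1 with k ℕ.% d ℕ.≟ 0
  ... | yes r≡0 = ℕ.m%n≡0⇒n∣m k d r≡0
  ... | no  r≢0 = contradiction (begin
    w ^ (k ℕ.% d)                                ≈⟨ *-identityʳ _ ⟨
    w ^ (k ℕ.% d) * 1#                           ≈⟨ *-congˡ (^-multiple≈1 w^d≈1 (ℕ.n∣m*n (k ℕ./ d))) ⟨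
    w ^ (k ℕ.% d) * w ^ (k ℕ./ d ℕ.* d)          ≈⟨ ^-homo-* w (k ℕ.% d) _ ⟨
    w ^ (k ℕ.% d ℕ.+ k ℕ./ d ℕ.* d)              ≡⟨ ≡.cong (w ^_) (ℕ.m≡m%n+[m/n]*n k d) ⟨
    w ^ k                                        ≈⟨ w^k≈1 ⟩
    1#                                           ∎)
    (minimal (k ℕ.% d) (ℕ.n≢0⇒n>0 r≢0) (ℕ.m%n<n k d))

  ∈-totatives⁺ : ∀ {d e} → 1 ℕ.≤ e → e ℕ.≤ d → Coprime e d → e ∈ totatives d
  ∈-totatives⁺ (s≤s z≤n) e≤d c = ∈-filter⁺ _ (∈-applyUpTo⁺ suc e≤d) (Coprimality.coprime⇒gcd≡1 c)

  ∈-totatives⁻ : ∀ {d e} → e ∈ totatives d → 1 ℕ.≤ e × e ℕ.≤ d × Coprime e d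
  ∈-totatives⁻ {d} e∈ with ∈-filter⁻ (λ j → gcd j d ℕ.≟ 1) {xs = applyUpTo suc d} e∈
  ... | e∈′ , gcd≡1 with _ , e<d , ≡.refl ← ∈-applyUpTo⁻ suc e∈′ =
    s≤s z≤n , e<d , Coprimality.gcd≡1⇒coprime gcd≡1

  root : ℕ × ℕ → Carrier
  root (d , e) = ω d ^ e

  IsIndex : ℕ × ℕ → Set
  IsIndex (d , e) = 1 ℕ.≤ d × e ∈ totatives d

  root-^-order : ∀ {d} e → 1 ℕ.≤ d → root (d , e) ^ d ≈ 1#
  root-^-order {d} e 1≤d =
    trans (^-assocʳ (ω d) e d) (^-multiple≈1 (proj₁ (ω-primitive d 1≤d)) (ℕ.n∣m*n e))

  root-order : ∀ {d e k} → IsIndex (d , e) → root (d , e) ^ k ≈ 1# → d ℕ.∣ k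
  root-order {d} {e} {k} (1≤d , e∈) eq =
    Coprimality.coprime-divisor (Coprimality.sym (proj₂ (proj₂ (∈-totatives⁻ e∈))))
      (order-divides 1≤d (ω-primitive d 1≤d) (trans (sym (^-assocʳ (ω d) e k)) eq))

  ^-injective : ∀ {d w e e′} → PrimitiveRoot d w → 1 ℕ.≤ e → e ℕ.≤ e′ → e′ ℕ.≤ d →
    w ^ e ≈ w ^ e′ → e ≡ e′
  ^-injective {d} {w} {e} {e′} prim 1≤e e≤e′ e′≤d eq with e′ ℕ.∸ e ℕ.≟ 0
  ... | yes δ≡0 = ℕ.≤-antisym e≤e′ (ℕ.m∸n≡0⇒m≤n δ≡0)
  ... | no  δ≢0 = contradiction
    (begin
      w ^ (e′ ℕ.∸ e)                         ≈⟨ *-identityʳ _ ⟨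
      w ^ (e′ ℕ.∸ e) * 1#                    ≈⟨ *-congˡ e+f ⟨
      w ^ (e′ ℕ.∸ e) * (w ^ e * w ^ f)       ≈⟨ *-assoc _ _ _ ⟨
      w ^ (e′ ℕ.∸ e) * w ^ e * w ^ f         ≈⟨ *-congʳ (^-homo-* w (e′ ℕ.∸ e) e) ⟨
      w ^ (e′ ℕ.∸ e ℕ.+ e) * w ^ f           ≡⟨ ≡.cong (λ k → w ^ k * w ^ f) (ℕ.m∸n+n≡m e≤e′) ⟩
      w ^ e′ * w ^ f                         ≈⟨ *-congʳ eq ⟨
      w ^ e * w ^ f                          ≈⟨ e+f ⟩
      1#                                     ∎)
    (proj₂ prim (e′ ℕ.∸ e) (ℕ.n≢0⇒n>0 δ≢0) (ℕ.<-≤-trans (ℕ.∸-monoʳ-< {e′} 1≤e e≤e′) e′≤d))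
    where
    -- `w ^ f` is the inverse of `w ^ e`, which turns equality of the two powers into
    -- `w ^ (e′ ∸ e) ≈ 1#`.
    f = d ℕ.∸ e
    e+f : w ^ e * w ^ f ≈ 1#
    e+f = begin
      w ^ e * w ^ f      ≈⟨ ^-homo-* w e f ⟨
      w ^ (e ℕ.+ f)      ≡⟨ ≡.cong (w ^_) (ℕ.m+[n∸m]≡n (ℕ.≤-trans e≤e′ e′≤d)) ⟩
      w ^ d              ≈⟨ proj₁ prim ⟩
      1#                 ∎

  -- The exponent e is prime to d, so d is the order of the root and can be recovered from it. There
  -- remain powers of one primitive root with exponents from 1 to d.
  root-injective : ∀ {i j} → IsIndex i → IsIndex j → root i ≈ root j → i ≡ j
  root-injective {d , e} {d′ , e′} i∈@(1≤d , e∈) j∈@(1≤d′ , e′∈) eq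
    with ≡.refl ← ℕ.∣-antisym
      (root-order i∈ (trans (^-congˡ d′ eq) (root-^-order e′ 1≤d′)))
      (root-order j∈ (trans (^-congˡ d (sym eq)) (root-^-order e 1≤d)))
    with 1≤e , e≤d , _ ← ∈-totatives⁻ e∈ | 1≤e′ , e′≤d , _ ← ∈-totatives⁻ e′∈
    with ℕ.≤-total e e′
  ... | inj₁ e≤e′ = ≡.cong (d ,_) (^-injective (ω-primitive d 1≤d) 1≤e e≤e′ e′≤d eq)
  ... | inj₂ e′≤e = ≡.cong (d ,_) (≡.sym (^-injective (ω-primitive d 1≤d) 1≤e′ e′≤e e≤d (sym eq)))

  indices : List ℕ → List (ℕ × ℕ)
  indices = concatMap (λ d → map (d ,_) (totatives d))

  ∈-indices⁺ : ∀ {d e ds} → d ∈ ds → e ∈ totatives d → (d , e) ∈ indices ds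
  ∈-indices⁺ d∈ e∈ = ∈-concatMap⁺ _ (lose d∈ (∈-map⁺ (_ ,_) e∈))

  ∈-indices⁻ : ∀ {d e} ds → (d , e) ∈ indices ds → d ∈ ds × e ∈ totatives d
  ∈-indices⁻ ds p with find (∈-concatMap⁻ _ {xs = ds} p)
  ... | d , d∈ , p′ with _ , e∈ , ≡.refl ← ∈-map⁻ (d ,_) p′ = d∈ , e∈

  indices-unique : ∀ {ds} → Unique ds → Unique (indices ds)
  indices-unique {ds} ds! = Unique.concat⁺
    (All.map⁺ (All.universal (λ d → Unique.map⁺ (λ { ≡.refl → ≡.refl })
      (Unique.filter⁺ _ (AllPairs.applyUpTo⁺₁ suc d (λ i<j _ eq → ℕ.<⇒≢ i<j (ℕ.suc-injective eq))))) ds))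
    (AllPairs.map⁺ (AllPairs.map disjoint ds!))
    where
    disjoint : ∀ {d d′} → d ≢ d′ → ∀ {i} →
      ¬ (i ∈ map (d ,_) (totatives d) × i ∈ map (d′ ,_) (totatives d′))
    disjoint d≢d′ (p , q) with _ , _ , ≡.refl ← ∈-map⁻ (_ ,_) p | _ , _ , eq ← ∈-map⁻ (_ ,_) q =
      d≢d′ (≡.cong proj₁ eq)

  module _ (N m : ℕ) (1≤N : 1 ℕ.≤ N) where
    private
      n  = N ℕ.* suc m
      ds = newDivisors N n

      1≤n : 1 ℕ.≤ n
      1≤n = ℕ.*-mono-≤ 1≤N (s≤s (z≤n {m}))

      index∈⇒IsIndex : ∀ {i} → i ∈ indices ds → IsIndex i
      index∈⇒IsIndex i∈ with d∈ , e∈ ← ∈-indices⁻ ds i∈ = proj₁ (∈-newDivisors⁻ {N} {n} d∈) , e∈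

      lowest : ∀ i → ∃₂ λ d e → 1 ℕ.≤ d × (d , e) ∈ indices ds × e ℕ.* n ≡ nonMultiple N m i ℕ.* d
      lowest i with lowestTerms (nonMultiple N m i) n (s≤s z≤n) 1≤n
      ... | d@(suc _) , e , 1≤d , 1≤e , d∣n , coprime , en≡jd =
        d , e , 1≤d , ∈-indices⁺ (∈-newDivisors⁺ 1≤d 1≤n d∣n d∤N) (∈-totatives⁺ 1≤e e≤d coprime) , en≡jd
        where
        e≤d : e ℕ.≤ d
        e≤d = ℕ.*-cancelʳ-≤ e d n {{ℕ.>-nonZero 1≤n}} (ℕ.≤-trans (ℕ.≤-reflexive en≡jd)
          (ℕ.≤-trans (ℕ.*-monoˡ-≤ d (nonMultiple-≤ N m i)) (ℕ.≤-reflexive (ℕ.*-comm n d))))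
        d∤N : ¬ d ℕ.∣ N
        -- If N = c d, then j d = e n = e c d (m + 1), and cancelling d makes j a multiple of m + 1.
        d∤N (ℕ.divides c N≡cd) = nonMultiple-∤ N m i (ℕ.divides (e ℕ.* c) (ℕ.*-cancelʳ-≡ _ _ d
          (≡.trans (≡.sym en≡jd) (≡.trans (≡.cong (λ k → e ℕ.* (k ℕ.* suc m)) N≡cd)
            (solve 4 (λ e c d k → e :* (c :* d :* k) := e :* c :* k :* d) ≡.refl e c d (suc m))))))
          where open ℕSolver

      position : Fin (N ℕ.* m) → Fin (length (indices ds))
      position i = let _ , _ , _ , i∈ , _ = lowest i in Any.index i∈

      position-injective : ∀ {i j} → position i ≡ position j → i ≡ j
      position-injective {i} {j} eq =
        let d , e , 1≤d , i∈ , p = lowest i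
            d′ , e′ , _ , j∈ , p′ = lowest j
            i≡j : (d , e) ≡ (d′ , e′)
            i≡j = index-injective (≡.setoid _) i∈ j∈ eq
        in nonMultiple-injective N m (ℕ.*-cancelʳ-≡ _ _ d {{ℕ.>-nonZero 1≤d}}
          (≡.trans (≡.sym p) (≡.trans (≡.cong (λ i → proj₂ i ℕ.* n) i≡j)
            (≡.trans p′ (≡.cong (λ i → nonMultiple N m j ℕ.* proj₁ i) (≡.sym i≡j))))))

    -- The pair (d , e) determines j through e n = j d, so the N m numbers j occupy different
    -- positions. This injection replaces a summation of totients; the left-hand side is the degree
    -- of the form to be factorised.
    length-indices : N ℕ.* m ℕ.≤ length (indices ds)
    length-indices = injective⇒≤ position-injective

    roots-distinct : AllPairs (λ r r′ → ¬ r ≈ r′) (map root (indices ds))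
    roots-distinct = AllPairs.map⁺ (distinct (indices-unique (newDivisors-unique N n)) index∈⇒IsIndex)
      where
      distinct : ∀ {is} → Unique is → (∀ {i} → i ∈ is → IsIndex i) →
        AllPairs (λ i j → ¬ root i ≈ root j) is
      distinct []          _  = []
      distinct (i∉is ∷ is!) ix =
        All.tabulate (λ j∈ eq → All.lookup i∉is j∈ (root-injective (ix (here ≡.refl)) (ix (there j∈)) eq))
        ∷ distinct is! (ix ∘ there)

    -- For such a root r, (r^N - 1) times the value telescopes to rⁿ - 1 = 0, and r^N ≠ 1 because
    -- the order d of r does not divide N. The predecessor N′ appears because `geometricTail` counts
    -- the zeros between consecutive ones.
    roots-vanish : ∀ {N′} → N ≡ suc N′ →
      All (λ r → value r (1# ∷ geometricTail N′ m) ≈ 0#) (map root (indices ds))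
    roots-vanish {N′} ≡.refl = All.map⁺ (All.tabulate vanish)
      where
      vanish : ∀ {i} → i ∈ indices ds → value (root i) (1# ∷ geometricTail N′ m) ≈ 0#
      vanish {i@(d , e)} i∈ with d∈ , e∈ ← ∈-indices⁻ ds i∈
        with 1≤d , d∣n , d∤N ← ∈-newDivisors⁻ {N} {n} d∈ = begin
        value r (1# ∷ geometricTail N′ m)
          ≈⟨ Value.form-geometric commutativeRing id-isRingHomomorphism r 1# N′ m ⟩
        geometricSum (r ^ N) (1# ^ N) m
          ≈⟨ *-cancelˡ-≈0 r^N≉1 telescoped ⟩
        0# ∎
        where
        r = root i
        r^N≉1 : ¬ r ^ N + - (1# ^ N) ≈ 0#
        r^N≉1 eq = d∤N (root-order (1≤d , e∈) (trans (x∙y⁻¹≈ε⇒x≈y _ _ eq) (1^n≈1 N)))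
        telescoped : (r ^ N + - (1# ^ N)) * geometricSum (r ^ N) (1# ^ N) m ≈ 0#
        telescoped = begin
          (r ^ N + - (1# ^ N)) * geometricSum (r ^ N) (1# ^ N) m   ≈⟨ geometricSum-telescopes _ _ m ⟩
          (r ^ N) ^ suc m + - ((1# ^ N) ^ suc m)                   ≈⟨ x≈y⇒x∙y⁻¹≈ε (begin
            (r ^ N) ^ suc m     ≈⟨ ^-assocʳ r N (suc m) ⟩
            r ^ n               ≈⟨ ^-multiple≈1 (root-^-order e 1≤d) d∣n ⟩
            1#                  ≈⟨ 1^n≈1 n ⟨
            1# ^ n              ≈⟨ ^-assocʳ 1# N (suc m) ⟨
            (1# ^ N) ^ suc m    ∎) ⟩
          0#                                                       ∎

  fromℤ-injective : ∀ {i j} → Evaluation.fromℤ rawRing i ≈ Evaluation.fromℤ rawRing j → i ≡ j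
  fromℤ-injective {i} {j} eq = ℤ.i-j≡0⇒i≡j i j (zero-kernel (i ℤ.- j) (begin
    fromℤ (i ℤ.- j)              ≈⟨ fromℤ.+-homo i (ℤ.- j) ⟩
    fromℤ i + fromℤ (ℤ.- j)      ≈⟨ +-congˡ (fromℤ.-‿homo j) ⟩
    fromℤ i + - fromℤ j          ≈⟨ x≈y⇒x∙y⁻¹≈ε eq ⟩
    0#                           ∎))
    where
    open Evaluation rawRing using (fromℤ)
    module fromℤ = IsRingHomomorphism (FromInteger.fromℤ-isRingHomomorphism commutativeRing)
    open Algebra.Properties.Ring ring using (-‿injective; -0#≈0#)
    zero-kernel : ∀ k → fromℤ k ≈ 0# → k ≡ ℤ.0ℤ
    zero-kernel (+ zero)  _  = ≡.refl
    zero-kernel (+ suc n) eq = contradiction eq (characteristicZero (suc n) (s≤s z≤n))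
    zero-kernel -[1+ n ]  eq =
      contradiction (-‿injective (trans eq (sym -0#≈0#))) (characteristicZero (suc n) (s≤s z≤n))

-- Products of atoms as Lucas numbers

-- V n = αⁿ + βⁿ, the companion Lucas sequence.

V : ℤ → ℤ → ℕ → ℤ
V s t 0             = + 2
V s t 1             = s
V s t (suc (suc n)) = s ℤ.* V s t (suc n) ℤ.+ t ℤ.* V s t n

discriminant : ℤ → ℤ → ℤ
discriminant s t = s ℤ.* s ℤ.+ + 4 ℤ.* t

-- αⁿ and βⁿ are the roots of x² − V n x − norm n.

norm : ℤ → ℕ → ℤ
norm t n = ℤ.- ((ℤ.- t) ℤ.^ n)

∏ : ∀ {a} {A : Set a} → (A → ℤ) → List A → ℤ
∏ f = foldr (λ x z → f x ℤ.* z) ℤ.1ℤ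

-- R is an overring of `K` with a root x of the characteristic polynomial; the other root is s - x.
-- Identities are computed in R and pulled back to the integers along the injective `fromℤ`. No
-- cancellation takes place in R, so it may have zero divisors and the two roots may coincide.
module LucasRoots {c ℓ c′ ℓ′} (K : DomainWithRootsOfUnity c ℓ) (s t : ℤ) (R : CommutativeRing c′ ℓ′)
  {ι : DomainWithRootsOfUnity.Carrier K → CommutativeRing.Carrier R}
  (ι-hom : IsRingHomomorphism (DomainWithRootsOfUnity.rawRing K) (CommutativeRing.rawRing R) ι)
  (ι-injective : ∀ {a b} → CommutativeRing._≈_ R (ι a) (ι b) → DomainWithRootsOfUnity._≈_ K a b)
  (x : CommutativeRing.Carrier R)
  (x²≈sx+t : CommutativeRing._≈_ R (CommutativeRing._*_ R x x) (CommutativeRing._+_ R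
    (CommutativeRing._*_ R (ι (Evaluation.fromℤ (DomainWithRootsOfUnity.rawRing K) s)) x)
    (ι (Evaluation.fromℤ (DomainWithRootsOfUnity.rawRing K) t)))) where

  private
    module K = DomainWithRootsOfUnity K
    module FromK = Evaluation K.rawRing
    module ι = IsRingHomomorphism ι-hom
    open Factorisation K
    open BinaryForm K.commutativeRing
    open RootsOfUnity K using (root; indices; roots-distinct; roots-vanish; length-indices; fromℤ-injective)

  open CommutativeRing R
  open Evaluation rawRing using (fromℤ; eval)
  open FromInteger R
  open Solver using (solve; _:=_; _:+_; _:*_; :-_; con)
  open GeometricSum R
  open Algebra.Properties.CommutativeSemiring.Exp commutativeSemiring
  open Relation.Binary.Reasoning.Setoid setoid

  private
    module fromℤ = IsRingHomomorphism fromℤ-isRingHomomorphism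

    y : Carrier
    y = fromℤ s + - x

    ι-fromℤ : ∀ i → ι (FromK.fromℤ i) ≈ fromℤ i
    ι-fromℤ = fromℤ-natural R ι-hom

    injective : ∀ {i j} → fromℤ i ≈ fromℤ j → i ≡ j
    injective {i} {j} eq = fromℤ-injective
      (ι-injective (trans (ι-fromℤ i) (trans eq (sym (ι-fromℤ j)))))

    x+y : x + y ≈ fromℤ s
    x+y = solve 2 (λ x s → x :+ (s :+ :- x) := s) refl x (fromℤ s)

    -xy : - (x * y) ≈ fromℤ t
    -xy = begin
      - (x * y)
        ≈⟨ solve 2 (λ x s → :- (x :* (s :+ :- x)) := x :* x :+ :- (s :* x)) refl x (fromℤ s) ⟩
      x * x + - (fromℤ s * x)
        ≈⟨ +-congʳ (trans x²≈sx+t (+-cong (*-congʳ (ι-fromℤ s)) (ι-fromℤ t))) ⟩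
      fromℤ s * x + fromℤ t + - (fromℤ s * x)
        ≈⟨ solve 2 (λ u t → u :+ t :+ :- u := t) refl (fromℤ s * x) (fromℤ t) ⟩
      fromℤ t ∎

    powerSum : ∀ n → x ^ n + y ^ n ≈ fromℤ (V s t n) × x ^ suc n + y ^ suc n ≈ fromℤ (V s t (suc n))
    powerSum zero    = solve 0 (con (+ 1) :+ con (+ 1) := con (+ 1) :+ (con (+ 1) :+ con (+ 0))) refl ,
      trans (+-cong (*-identityʳ x) (*-identityʳ y)) x+y
    powerSum (suc n) with p , q ← powerSum n = q , (begin
      x ^ suc (suc n) + y ^ suc (suc n)
        ≈⟨ solve 4 (λ x y u v → x :* (x :* u) :+ y :* (y :* v)
             := (x :+ y) :* (x :* u :+ y :* v) :+ :- (x :* y) :* (u :+ v)) refl x y (x ^ n) (y ^ n) ⟩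
      (x + y) * (x ^ suc n + y ^ suc n) + - (x * y) * (x ^ n + y ^ n)
        ≈⟨ +-cong (*-cong x+y q) (*-cong -xy p) ⟩
      fromℤ s * fromℤ (V s t (suc n)) + fromℤ t * fromℤ (V s t n)
        ≈⟨ +-cong (fromℤ.*-homo s (V s t (suc n))) (fromℤ.*-homo t (V s t n)) ⟨
      fromℤ (s ℤ.* V s t (suc n)) + fromℤ (t ℤ.* V s t n)
        ≈⟨ fromℤ.+-homo (s ℤ.* V s t (suc n)) (t ℤ.* V s t n) ⟨
      fromℤ (V s t (suc (suc n))) ∎)

    xⁿ+yⁿ : ∀ n → x ^ n + y ^ n ≈ fromℤ (V s t n)
    xⁿ+yⁿ n = proj₁ (powerSum n)

    xy : x * y ≈ fromℤ (ℤ.- t)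
    xy = trans (solve 1 (λ u → u := :- (:- u)) refl (x * y)) (trans (-‿cong -xy) (sym (fromℤ.-‿homo t)))

    fromℤ-^ : ∀ i n → fromℤ i ^ n ≈ fromℤ (i ℤ.^ n)
    fromℤ-^ i zero    = sym fromℤ.1#-homo
    fromℤ-^ i (suc n) = trans (*-congˡ (fromℤ-^ i n)) (sym (fromℤ.*-homo i (i ℤ.^ n)))

    -xⁿyⁿ : ∀ n → - (x ^ n * y ^ n) ≈ fromℤ (norm t n)
    -xⁿyⁿ n = begin
      - (x ^ n * y ^ n)             ≈⟨ -‿cong (^-distrib-* x y n) ⟨
      - ((x * y) ^ n)               ≈⟨ -‿cong (trans (^-congˡ n xy) (fromℤ-^ (ℤ.- t) n)) ⟩
      - fromℤ ((ℤ.- t) ℤ.^ n)         ≈⟨ fromℤ.-‿homo ((ℤ.- t) ℤ.^ n) ⟨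
      fromℤ (norm t n)              ∎

    fromℤ-discriminant : ∀ {a b} S T → a + b ≈ fromℤ S → - (a * b) ≈ fromℤ T →
      fromℤ (discriminant S T) ≈ (a + - b) * (a + - b)
    fromℤ-discriminant {a} {b} S T a+b -ab = begin
      fromℤ (S ℤ.* S ℤ.+ + 4 ℤ.* T)
        ≈⟨ trans (fromℤ.+-homo (S ℤ.* S) (+ 4 ℤ.* T)) (+-cong (fromℤ.*-homo S S) (fromℤ.*-homo (+ 4) T)) ⟩
      fromℤ S * fromℤ S + fromℤ (+ 4) * fromℤ T
        ≈⟨ +-cong (*-cong a+b a+b) (*-congˡ -ab) ⟨
      (a + b) * (a + b) + fromℤ (+ 4) * - (a * b)
        ≈⟨ solve 2 (λ a b → (a :+ b) :* (a :+ b) :+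
             (con (+ 1) :+ (con (+ 1) :+ (con (+ 1) :+ (con (+ 1) :+ con (+ 0))))) :* :- (a :* b)
             := (a :+ :- b) :* (a :+ :- b)) refl a b ⟩
      (a + - b) * (a + - b) ∎

  -- Both sides are (αⁿ - βⁿ)² at index n + 1: on the left as the discriminant of the quadratic with
  -- these powers as roots, on the right through αⁿ - βⁿ = (α - β) Uₙ. The square of U is what later
  -- yields p² rather than p.
  discriminant-identity : ∀ n → discriminant (V s t (suc n)) (norm t (suc n)) ≡
    discriminant s t ℤ.* (U s t (suc n) ℤ.* U s t (suc n))
  discriminant-identity n = injective (begin
    fromℤ (discriminant (V s t (suc n)) (norm t (suc n)))
      ≈⟨ fromℤ-discriminant (V s t (suc n)) (norm t (suc n)) (xⁿ+yⁿ (suc n)) (-xⁿyⁿ (suc n)) ⟩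
    (x ^ suc n + - (y ^ suc n)) * (x ^ suc n + - (y ^ suc n))
      ≈⟨ *-cong (geometricSum-telescopes x y n) (geometricSum-telescopes x y n) ⟨
    ((x + - y) * g) * ((x + - y) * g)
      ≈⟨ solve 2 (λ d g → (d :* g) :* (d :* g) := (d :* d) :* (g :* g)) refl (x + - y) g ⟩
    ((x + - y) * (x + - y)) * (g * g)
      ≈⟨ *-cong (fromℤ-discriminant s t x+y -xy) (trans (fromℤ.*-homo u u) (*-cong (sym g≈u) (sym g≈u))) ⟨
    fromℤ (discriminant s t) * fromℤ (u ℤ.* u)
      ≈⟨ fromℤ.*-homo (discriminant s t) (u ℤ.* u) ⟨
    fromℤ (discriminant s t ℤ.* (u ℤ.* u)) ∎)
    where
    u = U s t (suc n)
    g = geometricSum x y n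
    g≈u : g ≈ fromℤ u
    g≈u = geometricSum-lucas s t x+y -xy n

  module _ {P : ℕ → RawRing.Carrier ℤ[s,t]} (atoms : IsLucasAtoms K P) where
    private
      open LucasAtoms K using (K[α,β]; α; β; Φ; scalar; totatives)
      module Poly = RawRing K[α,β]
      open Value R ι-hom x y

      at-x-hom = horner-isRingHomomorphism R ι-hom x
      at-xy-hom = horner-isRingHomomorphism R at-x-hom y
      module at-xy = IsRingHomomorphism at-xy-hom

      at-xy : Poly.Carrier → Carrier
      at-xy = Evaluation.horner rawRing (Evaluation.horner rawRing ι x) y

      at-xy-scalar : ∀ a → at-xy (scalar a) ≈ ι a
      at-xy-scalar a = trans (horner-const R at-x-hom y (Polynomial.const K.rawRing a))
        (horner-const R ι-hom x a)

      at-xy-α : at-xy α ≈ x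
      at-xy-α = trans (horner-const R at-x-hom y (Polynomial.var K.rawRing))
        (horner-var R ι-hom x)

      at-xy-β : at-xy β ≈ y
      at-xy-β = horner-var R at-x-hom y

      linears : List K.Carrier → Carrier
      linears = linearProduct R ι-hom x y

      at-xy-Φ : ∀ n → at-xy (Φ n) ≈ linears (map (λ j → K.ω n K.^ j) (totatives n))
      at-xy-Φ n = go (totatives n)
        where
        factor : ℕ → Poly.Carrier
        factor j = α Poly.+ Poly.- (scalar (K.ω n K.^ j) Poly.* β)

        at-xy-factor : ∀ j → at-xy (factor j) ≈ linear (K.ω n K.^ j)
        at-xy-factor j = let ωʲ = scalar (K.ω n K.^ j) in begin
          at-xy (factor j)
            ≈⟨ at-xy.+-homo α (Poly.- (ωʲ Poly.* β)) ⟩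
          at-xy α + at-xy (Poly.- (ωʲ Poly.* β))
            ≈⟨ +-cong at-xy-α (at-xy.-‿homo (ωʲ Poly.* β)) ⟩
          x + - at-xy (ωʲ Poly.* β)
            ≈⟨ +-congˡ (-‿cong (at-xy.*-homo ωʲ β)) ⟩
          x + - (at-xy ωʲ * at-xy β)
            ≈⟨ +-congˡ (-‿cong (*-cong (at-xy-scalar (K.ω n K.^ j)) at-xy-β)) ⟩
          linear (K.ω n K.^ j) ∎

        go : ∀ js → at-xy (foldr Poly._*_ Poly.1# (map factor js)) ≈ linears (map (λ j → K.ω n K.^ j) js)
        go []       = at-xy.1#-homo
        go (j ∷ js) = trans (at-xy.*-homo (factor j) (foldr Poly._*_ Poly.1# (map factor js)))
          (*-cong (at-xy-factor j) (go js))

      -- The roots x and y are substituted for `α` and `β` in the defining identity, where x + y = s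
      -- and -xy = t. The bound on n matters: P₁ = 1, whereas Φ₁ = α - β.
      fromℤ-atom : ∀ n → 2 ℕ.≤ n →
        fromℤ (P n ⟨ s , t ⟩) ≈ linears (map (λ j → K.ω n K.^ j) (totatives n))
      fromℤ-atom n 2≤n = begin
        fromℤ (P n ⟨ s , t ⟩)
          ≈⟨ eval-natural R fromℤ-isRingHomomorphism (P n) refl refl ⟩
        eval (P n) (fromℤ s) (fromℤ t)
          ≈⟨ eval-natural R at-xy-hom (P n)
               (trans (at-xy.+-homo α β) (trans (+-cong at-xy-α at-xy-β) x+y))
               (trans (at-xy.-‿homo (α Poly.* β))
                 (trans (-‿cong (trans (at-xy.*-homo α β) (*-cong at-xy-α at-xy-β))) -xy)) ⟨
        at-xy (Evaluation.eval K[α,β] (P n) (α Poly.+ β) (Poly.- (α Poly.* β)))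
          ≈⟨ at-xy.⟦⟧-cong {x = Evaluation.eval K[α,β] (P n) (α Poly.+ β) (Poly.- (α Poly.* β))} {y = Φ n}
               (IsLucasAtoms.Pₙ atoms n 2≤n) ⟩
        at-xy (Φ n)
          ≈⟨ at-xy-Φ n ⟩
        linears (map (λ j → K.ω n K.^ j) (totatives n)) ∎

      linears-++ : ∀ rs rs′ → linears (rs ++ rs′) ≈ linears rs * linears rs′
      linears-++ []       rs′ = sym (*-identityˡ _)
      linears-++ (r ∷ rs) rs′ = trans (*-congˡ (linears-++ rs rs′)) (sym (*-assoc _ _ _))

      Pₛₜ : ℕ → ℤ
      Pₛₜ d = P d ⟨ s , t ⟩

      fromℤ-∏ : ∀ ds → All (2 ℕ.≤_) ds →
        fromℤ (∏ Pₛₜ ds) ≈ linears (map root (indices ds))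
      fromℤ-∏ []       []           = fromℤ.1#-homo
      fromℤ-∏ (d ∷ ds) (2≤d ∷ 2≤ds) = begin
        fromℤ (P d ⟨ s , t ⟩ ℤ.* ∏ Pₛₜ ds)
          ≈⟨ fromℤ.*-homo (P d ⟨ s , t ⟩) (∏ Pₛₜ ds) ⟩
        fromℤ (P d ⟨ s , t ⟩) * fromℤ (∏ Pₛₜ ds)
          ≈⟨ *-cong (fromℤ-atom d 2≤d) (fromℤ-∏ ds 2≤ds) ⟩
        linears (map (λ j → K.ω d K.^ j) (totatives d)) * linears (map root (indices ds))
          ≡⟨ ≡.cong (λ rs → linears rs * linears (map root (indices ds))) (map-∘ (totatives d)) ⟩
        linears (map root (map (d ,_) (totatives d))) * linears (map root (indices ds))
          ≈⟨ linears-++ (map root (map (d ,_) (totatives d))) (map root (indices ds)) ⟨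
        linears (map root (map (d ,_) (totatives d)) ++ map root (indices ds))
          ≡⟨ ≡.cong linears (map-++ root (map (d ,_) (totatives d)) (indices ds)) ⟨
        linears (map root (indices (d ∷ ds))) ∎

    -- The form Σ_{i<m} x^{Ni}, homogenised, is evaluated at the two roots twice: as the product of
    -- its linear factors, grouped by the order d, and as a geometric sum in their N-th powers. As 1
    -- divides N, only atoms of index at least 2 occur.
    ∏-newDivisors : ∀ {N m} → 1 ℕ.≤ N → 1 ℕ.≤ m →
      ∏ (λ d → P d ⟨ s , t ⟩) (newDivisors N (N ℕ.* m)) ≡ U (V s t N) (norm t N) m
    ∏-newDivisors {suc N} {suc m} _ _ = injective (begin
      fromℤ (∏ Pₛₜ ds)
        ≈⟨ fromℤ-∏ ds (All.tabulate 2≤) ⟩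
      linears rs
        ≈⟨ trans (*-congʳ ι.1#-homo) (*-identityˡ _) ⟨
      ι K.1# * linears rs
        ≈⟨ factorisation R ι-hom x y rs K.1# (geometricTail N m)
             1≉0 (roots-distinct (suc N) m (s≤s z≤n)) (roots-vanish (suc N) m (s≤s z≤n) ≡.refl)
             (ℕ.≤-trans (ℕ.≤-reflexive (≡.trans (length-geometricTail N m) (ℕ.*-comm m (suc N))))
               (ℕ.≤-trans (length-indices (suc N) m (s≤s z≤n))
                 (ℕ.≤-reflexive (≡.sym (length-map root (indices ds)))))) ⟨
      form (K.1# ∷ geometricTail N m)
        ≈⟨ form-geometric N m ⟩
      geometricSum (x ^ suc N) (y ^ suc N) m
        ≈⟨ geometricSum-lucas (V s t (suc N)) (norm t (suc N)) (xⁿ+yⁿ (suc N)) (-xⁿyⁿ (suc N)) m ⟩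
      fromℤ (U (V s t (suc N)) (norm t (suc N)) (suc m)) ∎)
      where
      ds = newDivisors (suc N) (suc N ℕ.* suc m)
      rs = map root (indices ds)
      1≉0 : ¬ K.1# K.≈ K.0#
      1≉0 eq = K.characteristicZero 1 (s≤s z≤n) (K.trans (K.+-identityʳ K.1#) eq)
      2≤ : ∀ {d} → d ∈ ds → 2 ℕ.≤ d
      2≤ {d} d∈ with 1≤d , _ , d∤N ← ∈-newDivisors⁻ {suc N} {suc N ℕ.* suc m} d∈ =
        ℕ.≤∧≢⇒< 1≤d λ { ≡.refl → d∤N (ℕ.1∣ suc N) }

open import Data.Integer.Divisibility using (_∣_)
open import Data.Nat.Base using (_*_; _^_; _≤_)

-- Divisibility and valuations of Lucas numbers

-- With m + 1 the rank of p, the first term vanishes modulo p, so this formula compares U at indices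
-- that differ by the rank.
U-+ : ∀ s t m n → U s t (suc (m ℕ.+ n)) ≡ U s t (suc m) ℤ.* U s t (suc n) ℤ.+ t ℤ.* U s t m ℤ.* U s t n
U-+ s t zero          n =
  solve 3 (λ t a b → a := con 1ℤ :* a :+ t :* con 0ℤ :* b) ≡.refl t (U s t (suc n)) (U s t n)
  where open ℤSolver
U-+ s t (suc zero)    n =
  solve 4 (λ s t a b → s :* a :+ t :* b := (s :* con 1ℤ :+ t :* con 0ℤ) :* a :+ t :* con 1ℤ :* b)
    ≡.refl s t (U s t (suc n)) (U s t n)
  where open ℤSolver
U-+ s t (suc (suc m)) n = ≡.trans
  (≡.cong₂ (λ a b → s ℤ.* a ℤ.+ t ℤ.* b) (U-+ s t (suc m) n) (U-+ s t m n))
  (solve 6 (λ s t u v a b →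
      s :* ((s :* u :+ t :* v) :* a :+ t :* u :* b) :+ t :* (u :* a :+ t :* v :* b)
      := (s :* (s :* u :+ t :* v) :+ t :* u) :* a :+ t :* (s :* u :+ t :* v) :* b)
    ≡.refl s t (U s t (suc m)) (U s t m) (U s t (suc n)) (U s t n))
  where open ℤSolver

-- The roots α, β of x² − Sx − T coincide modulo q, so U (m + 1) is (m + 1) αᵐ there, and S = 2α.

U-mod-discriminant : ∀ {q} S T → q Signed.∣ discriminant S T → ∀ m →
  q Signed.∣ (+ 2) ℤ.^ m ℤ.* U S T (suc m) ℤ.- + suc m ℤ.* S ℤ.^ m
U-mod-discriminant {q} S T q∣D = λ m → proj₁ (both m)
  where
  open ℤSolver
  E : ℕ → ℤ
  E m = (+ 2) ℤ.^ m ℤ.* U S T (suc m) ℤ.- + suc m ℤ.* S ℤ.^ m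
  -- The factor 2ᵐ clears the denominator of S/2. The scaled U satisfies W_{m+2} = 2S W_{m+1} + 4T
  -- W_m exactly, and (m + 1) Sᵐ does so up to a multiple of the discriminant.
  E-recurrence : ∀ m → E (suc (suc m)) ≡
    + 2 ℤ.* S ℤ.* E (suc m) ℤ.+ (+ 4 ℤ.* T ℤ.* E m ℤ.+ + suc m ℤ.* S ℤ.^ m ℤ.* discriminant S T)
  E-recurrence m = solve 7 (λ S T a u v b c →
    con (+ 2) :* (con (+ 2) :* a) :* (S :* v :+ T :* u) :- (con (+ 3) :+ c) :* (S :* (S :* b))
    := con (+ 2) :* S :* (con (+ 2) :* a :* v :- (con (+ 2) :+ c) :* (S :* b))
      :+ (con (+ 4) :* T :* (a :* u :- (con (+ 1) :+ c) :* b)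
      :+ (con (+ 1) :+ c) :* b :* (S :* S :+ con (+ 4) :* T)))
    ≡.refl S T ((+ 2) ℤ.^ m) (U S T (suc m)) (U S T (suc (suc m))) (S ℤ.^ m) (+ m)
  both : ∀ m → q Signed.∣ E m × q Signed.∣ E (suc m)
  both zero    = Signed.divides 0ℤ ≡.refl , Signed.divides 0ℤ
    (solve 2 (λ S T →
      con (+ 2) :* con (+ 1) :* (S :* con (+ 1) :+ T :* con (+ 0)) :- con (+ 2) :* (S :* con (+ 1))
      := con (+ 0)) ≡.refl S T)
  both (suc m) with p , p′ ← both m = p′ , ≡.subst (q Signed.∣_) (≡.sym (E-recurrence m))
    (Signed.∣m∣n⇒∣m+n (Signed.∣n⇒∣m*n (+ 2 ℤ.* S) p′)
      (Signed.∣m∣n⇒∣m+n (Signed.∣n⇒∣m*n (+ 4 ℤ.* T) p) (Signed.∣n⇒∣m*n (+ suc m ℤ.* S ℤ.^ m) q∣D)))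

∣-difference : ∀ {q} a b → q Signed.∣ a ℤ.- b → q Signed.∣ a → q Signed.∣ b
∣-difference a b q∣a-b q∣a = ≡.subst (_ Signed.∣_)
  (solve 2 (λ a b → a :- (a :- b) := b) ≡.refl a b) (Signed.∣m∣n⇒∣m-n q∣a q∣a-b)
  where open ℤSolver

∣-difference′ : ∀ {q} a b → q Signed.∣ a ℤ.- b → q Signed.∣ b → q Signed.∣ a
∣-difference′ a b q∣a-b q∣b = ≡.subst (_ Signed.∣_)
  (solve 2 (λ a b → (a :- b) :+ b := a) ≡.refl a b) (Signed.∣m∣n⇒∣m+n q∣a-b q∣b)
  where open ℤSolver

^-∣ : ∀ p {i j} → i ≤ j → p ^ i ℕ.∣ p ^ j
^-∣ p {i} {j} i≤j = ≡.subst (p ^ i ℕ.∣_)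
  (≡.trans (≡.sym (ℕ.^-distribˡ-+-* p i (j ℕ.∸ i))) (≡.cong (p ^_) (ℕ.m+[n∸m]≡n i≤j)))
  (ℕ.m∣m*n (p ^ (j ℕ.∸ i)))

n<p^n : ∀ {p} → 2 ≤ p → ∀ n → n ℕ.< p ^ n
n<p^n 2≤p zero    = s≤s z≤n
n<p^n {p} 2≤p (suc n) = begin-strict
  suc n            ≤⟨ n<p^n 2≤p n ⟩
  p ^ n            <⟨ ℕ.^-monoʳ-< p 2≤p (ℕ.n<1+n n) ⟩
  p ^ suc n        ∎
  where open ℕ.≤-Reasoning

maxExponent-∣ : ∀ p m b → p ^ maxExponent p m b ℕ.∣ m
maxExponent-∣ p m zero    = ℕ.1∣ m
maxExponent-∣ p m (suc b) with (p ^ suc b) ℕ.∣? m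
... | yes p∣ = p∣
... | no  _  = maxExponent-∣ p m b

≤-maxExponent : ∀ p m b {e} → e ≤ b → p ^ e ℕ.∣ m → e ≤ maxExponent p m b
≤-maxExponent p m zero    z≤n    _ = z≤n
≤-maxExponent p m (suc b) {e} e≤1+b p^e∣m with (p ^ suc b) ℕ.∣? m
... | yes _  = e≤1+b
... | no  p∤ = ≤-maxExponent p m b
  (ℕ.s≤s⁻¹ (ℕ.≤∧≢⇒< e≤1+b λ { ≡.refl → p∤ p^e∣m })) p^e∣m

∣⇒≤maxExponent : ∀ {p m e} → 2 ≤ p → 1 ≤ m → p ^ e ℕ.∣ m → e ≤ maxExponent p m m
∣⇒≤maxExponent {p} {m} {e} 2≤p 1≤m p^e∣m = ≤-maxExponent p m m
  (ℕ.<⇒≤ (ℕ.<-≤-trans (n<p^n 2≤p e) (ℕ.∣⇒≤ {{ℕ.>-nonZero 1≤m}} p^e∣m))) p^e∣m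

maxExponent-unique : ∀ {p m e} → 2 ≤ p → 1 ≤ m → p ^ e ℕ.∣ m → ¬ p ^ suc e ℕ.∣ m → maxExponent p m m ≡ e
maxExponent-unique {p} {m} {e} 2≤p 1≤m p^e∣m p^1+e∤m = ℕ.≤-antisym
  (ℕ.≮⇒≥ λ e<max → p^1+e∤m (ℕ.∣-trans (^-∣ p e<max) (maxExponent-∣ p m m)))
  (∣⇒≤maxExponent 2≤p 1≤m p^e∣m)

-- The last hypothesis also excludes x = 0, whose valuation is infinite.
valuation-unique : ∀ {p e} x → 2 ≤ p → p ^ e ℕ.∣ ℤ.∣ x ∣ → ¬ p ^ suc e ℕ.∣ ℤ.∣ x ∣ → v p x ≡ [ e ]
valuation-unique {p} {e} x 2≤p p^e∣x p^1+e∤x with ℤ.∣ x ∣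
... | zero  = contradiction ((p ^ suc e) ℕ.∣0) p^1+e∤x
... | suc m = ≡.cong [_] (maxExponent-unique 2≤p (s≤s z≤n) p^e∣x p^1+e∤x)

module _ {p : ℕ} (p-prime : Prime p) where

  private
    2≤p : 2 ≤ p
    2≤p = ℕ.nonTrivial⇒n>1 p {{prime⇒nonTrivial p-prime}}

    instance
      p≢0 : ℕ.NonZero p
      p≢0 = prime⇒nonZero p-prime

  euclidsLemmaℤ : ∀ a b → + p ∣ a ℤ.* b → + p ∣ a ⊎ + p ∣ b
  euclidsLemmaℤ a b p∣ab = euclidsLemma ℤ.∣ a ∣ ℤ.∣ b ∣ p-prime (≡.subst (p ℕ.∣_) (ℤ.abs-* a b) p∣ab)

  ∤1 : ¬ + p ∣ 1ℤ
  ∤1 p∣1 = ℕ.<⇒≱ 2≤p (ℕ.∣⇒≤ p∣1)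

  ∤-* : ∀ {a b} → ¬ + p ∣ a → ¬ + p ∣ b → ¬ + p ∣ a ℤ.* b
  ∤-* {a} {b} p∤a p∤b = [ p∤a , p∤b ]′ ∘ euclidsLemmaℤ a b

  ∤-^ : ∀ {a} → ¬ + p ∣ a → ∀ n → ¬ + p ∣ a ℤ.^ n
  ∤-^ p∤a zero    = ∤1
  ∤-^ {a} p∤a (suc n) = ∤-* {a} p∤a (∤-^ {a} p∤a n)

  p^∣*⇒p^∣ : ∀ e {a b} → ¬ p ℕ.∣ b → p ^ e ℕ.∣ a * b → p ^ e ℕ.∣ a
  p^∣*⇒p^∣ zero    {a} p∤b _ = ℕ.1∣ a
  p^∣*⇒p^∣ (suc e) {a} {b} p∤b p^1+e∣ab with euclidsLemma a b p-prime (ℕ.∣-trans (ℕ.m∣m*n (p ^ e)) p^1+e∣ab)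
  ... | inj₂ p∣b = contradiction p∣b p∤b
  ... | inj₁ (ℕ.divides-refl q) = ≡.subst (p ℕ.* p ^ e ℕ.∣_) (ℕ.*-comm p q) (ℕ.*-monoʳ-∣ p
    (p^∣*⇒p^∣ e p∤b (ℕ.*-cancelˡ-∣ p (≡.subst (p ℕ.* p ^ e ℕ.∣_)
      (solve 3 (λ q p b → q :* p :* b := p :* (q :* b)) ≡.refl q p b) p^1+e∣ab))))
    where open ℕSolver

  -- The case x = 0, with both sides infinite, has to be included because U at the rank can be zero.
  valuation-*-unit : ∀ x y → ¬ + p ∣ y → v p (x ℤ.* y) ≡ v p x
  valuation-*-unit x y p∤y = ≡.trans (≡.cong (valuationℕ p) (ℤ.abs-* x y)) (go ℤ.∣ x ∣)
    where
    go : ∀ a → valuationℕ p (a ℕ.* ℤ.∣ y ∣) ≡ valuationℕ p a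
    go zero    = ≡.refl
    go (suc a) = valuation-unique (+ (suc a ℕ.* ℤ.∣ y ∣)) 2≤p
      (ℕ.∣m⇒∣m*n ℤ.∣ y ∣ (maxExponent-∣ p (suc a) (suc a)))
      (λ p^∣ → ℕ.1+n≰n (∣⇒≤maxExponent {p} {suc a} 2≤p (s≤s z≤n)
        (p^∣*⇒p^∣ (suc (maxExponent p (suc a) (suc a))) p∤y p^∣)))

  ∤⇒valuation≡0 : ∀ x → ¬ + p ∣ x → v p x ≡ [ 0 ]
  ∤⇒valuation≡0 x p∤x = valuation-unique x 2≤p (ℕ.1∣ _) (p∤x ∘ ≡.subst (ℕ._∣ ℤ.∣ x ∣) (ℕ.*-identityʳ p))

  module _ {a} {A : Set a} (f : A → ℤ) where

    ∤-∏ : ∀ {ds} → (∀ {d} → d ∈ ds → ¬ + p ∣ f d) → ¬ + p ∣ ∏ f ds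
    ∤-∏ {[]}     _   = ∤1
    ∤-∏ {d ∷ ds} p∤f = ∤-* {f d} (p∤f (here ≡.refl)) (∤-∏ (p∤f ∘ there))

    ∣-∏ : ∀ {d ds} → d ∈ ds → + p ∣ f d → + p ∣ ∏ f ds
    ∣-∏ {d} {ds = _ ∷ ds} (here ≡.refl) p∣fd =
      ≡.subst (p ℕ.∣_) (≡.sym (ℤ.abs-* (f d) (∏ f ds))) (ℕ.∣m⇒∣m*n ℤ.∣ ∏ f ds ∣ p∣fd)
    ∣-∏ {d} {ds = e ∷ ds} (there d∈) p∣fd =
      ≡.subst (p ℕ.∣_) (≡.sym (ℤ.abs-* (f e) (∏ f ds))) (ℕ.∣n⇒∣m*n ℤ.∣ f e ∣ (∣-∏ d∈ p∣fd))

    -- All factors but one are prime to p; `Unique` ensures that the exceptional one is not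
    -- repeated.
    valuation-∏ : ∀ {n ds} → Unique ds → n ∈ ds → (∀ {d} → d ∈ ds → d ≢ n → ¬ + p ∣ f d) →
      v p (∏ f ds) ≡ v p (f n)
    valuation-∏ {n} {_ ∷ ds} (n∉ds ∷ _) (here ≡.refl) p∤f = valuation-*-unit (f n) (∏ f ds)
      (∤-∏ (λ d∈ → p∤f (there d∈) (All.lookup n∉ds d∈ ∘ ≡.sym)))
    valuation-∏ {n} {d ∷ ds} (d∉ds ∷ ds!) (there n∈) p∤f = ≡.trans
      (≡.cong (v p) (ℤ.*-comm (f d) (∏ f ds)))
      (≡.trans (valuation-*-unit (∏ f ds) (f d) (p∤f (here ≡.refl) (All.lookup d∉ds n∈)))
        (valuation-∏ ds! n∈ (p∤f ∘ there)))

  module _ (3≤p : 3 ≤ p) {S T : ℤ} (p∤T : ¬ + p ∣ T) where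

    ∤2 : ¬ + p ∣ + 2
    ∤2 p∣2 = ℕ.<⇒≱ 3≤p (ℕ.∣⇒≤ p∣2)

    -- Otherwise p would divide 4T as well, though it is odd and prime to T.
    ∤S : + p Signed.∣ discriminant S T → ¬ + p ∣ S
    ∤S p∣D p∣S = ∤-* {+ 4} {T} (∤-* {+ 2} {+ 2} ∤2 ∤2) p∤T (Signed.∣⇒∣ᵤ (Signed.∣m+n∣m⇒∣n {m = S ℤ.* S} p∣D
      (Signed.∣n⇒∣m*n S (Signed.∣ᵤ⇒∣ {i = S} p∣S))))

    -- At a positive index m, 2^{m-1} U_m is congruent to m S^{m-1} modulo p, and the latter is
    -- prime to p.
    ∤-U : + p Signed.∣ discriminant S T → ∀ m → ¬ p ℕ.∣ m → ¬ + p ∣ U S T m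
    ∤-U p∣D zero    p∤m _    = p∤m (p ℕ.∣0)
    ∤-U p∣D (suc m) p∤m p∣U = ∤-* {+ suc m} {S ℤ.^ m} p∤m (∤-^ {S} (∤S p∣D) m) (Signed.∣⇒∣ᵤ
      (∣-difference ((+ 2) ℤ.^ m ℤ.* U S T (suc m)) (+ suc m ℤ.* S ℤ.^ m) (U-mod-discriminant S T p∣D m)
        (Signed.∣n⇒∣m*n ((+ 2) ℤ.^ m) (Signed.∣ᵤ⇒∣ {i = U S T (suc m)} p∣U))))

    -- At index p the congruence reads 2^{p-1} U_p ≡ p S^{p-1} modulo p². As 2 and S are prime to p,
    -- exactly one factor p remains.
    valuation-U-prime : + (p * p) Signed.∣ discriminant S T → v p (U S T p) ≡ [ 1 ]
    valuation-U-prime p²∣D = valuation-unique (U S T p) 2≤p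
      (≡.subst (ℕ._∣ ℤ.∣ U S T p ∣) (≡.sym (ℕ.*-identityʳ p)) (p∣U p ≡.refl))
      (p²∤U p ≡.refl ∘ ≡.subst (ℕ._∣ ℤ.∣ U S T p ∣) (≡.cong (p ℕ.*_) (ℕ.*-identityʳ p)))
      where
      p∣D : + p Signed.∣ discriminant S T
      p∣D = Signed.∣-trans (Signed.∣ᵤ⇒∣ (ℕ.m∣m*n p)) p²∣D
      -- The index is a variable equal to p, so that it can be matched against `suc m`, the shape in
      -- which the congruence is stated.
      p∣U : ∀ m → m ≡ p → p ℕ.∣ ℤ.∣ U S T m ∣
      p∣U zero    _    = p ℕ.∣0
      p∣U (suc m) 1+m≡p with euclidsLemmaℤ ((+ 2) ℤ.^ m) (U S T (suc m)) (Signed.∣⇒∣ᵤ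
        (∣-difference′ ((+ 2) ℤ.^ m ℤ.* U S T (suc m)) (+ suc m ℤ.* S ℤ.^ m) (U-mod-discriminant S T p∣D m)
          (Signed.∣m⇒∣m*n (S ℤ.^ m) (Signed.∣-reflexive (≡.cong +_ (≡.sym 1+m≡p))))))
      ... | inj₁ p∣2^m = contradiction p∣2^m (∤-^ {+ 2} ∤2 m)
      ... | inj₂ p∣U   = p∣U
      p²∤U : ∀ m → m ≡ p → ¬ p * p ℕ.∣ ℤ.∣ U S T m ∣
      p²∤U zero    0≡p   _    = ℕ.m<n⇒n≢0 2≤p (≡.sym 0≡p)
      p²∤U (suc m) 1+m≡p p²∣U = ∤-^ {S} (∤S p∣D) m (ℕ.*-cancelˡ-∣ p
        (≡.subst (p * p ℕ.∣_) (≡.trans (ℤ.abs-* (+ suc m) (S ℤ.^ m)) (≡.cong (_* ℤ.∣ S ℤ.^ m ∣) 1+m≡p))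
          (Signed.∣⇒∣ᵤ (∣-difference ((+ 2) ℤ.^ m ℤ.* U S T (suc m)) (+ suc m ℤ.* S ℤ.^ m)
            (U-mod-discriminant S T p²∣D m)
            (Signed.∣n⇒∣m*n ((+ 2) ℤ.^ m) (Signed.∣ᵤ⇒∣ {i = U S T (suc m)} p²∣U))))))

  -- Divisibility of Lucas numbers and the rank of appearance

  module _ {s t : ℤ} (p∤t : ¬ + p ∣ t) {k : ℕ} (rank : IsRankOfAppearance p (U s t) k) where
    open IsRankOfAppearance rank

    2≤rank : 2 ≤ k
    2≤rank = ℕ.≤∧≢⇒< positive λ { ≡.refl → ∤1 divides }

    -- In U_{k+j} = U_k U_{j+1} + t U_{k-1} U_j the first term is divisible by p. The coefficient t
    -- U_{k-1} is not: k - 1 is at least 1 and smaller than the rank.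
    U-shift : ∀ j → (+ p ∣ U s t (k ℕ.+ j) → + p ∣ U s t j) × (+ p ∣ U s t j → + p ∣ U s t (k ℕ.+ j))
    U-shift = go k ≡.refl
      where
      go : ∀ k′ → k ≡ k′ → ∀ j →
        (+ p ∣ U s t (k′ ℕ.+ j) → + p ∣ U s t j) × (+ p ∣ U s t j → + p ∣ U s t (k′ ℕ.+ j))
      -- The rank is never 0, but both implications are trivial there.
      go zero    k≡0   j = id , id
      go (suc i) k≡1+i j = down , up
        where
        uᵢ₊₁ : + p Signed.∣ U s t (suc i) ℤ.* U s t (suc j)
        uᵢ₊₁ = Signed.∣m⇒∣m*n (U s t (suc j)) (Signed.∣ᵤ⇒∣ {i = U s t (suc i)}
          (≡.subst (λ m → + p ∣ U s t m) k≡1+i divides))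
        1≤i : 1 ≤ i
        1≤i = ℕ.s≤s⁻¹ (≡.subst (2 ≤_) k≡1+i 2≤rank)
        p∤uᵢ : ¬ + p ∣ U s t i
        p∤uᵢ p∣uᵢ = ℕ.1+n≰n (≡.subst (_≤ i) k≡1+i (least i 1≤i p∣uᵢ))
        down : + p ∣ U s t (suc i ℕ.+ j) → + p ∣ U s t j
        down p∣U with euclidsLemmaℤ (t ℤ.* U s t i) (U s t j) (Signed.∣⇒∣ᵤ
          (Signed.∣m+n∣m⇒∣n {m = U s t (suc i) ℤ.* U s t (suc j)}
            (≡.subst (+ p Signed.∣_) (U-+ s t i j) (Signed.∣ᵤ⇒∣ {i = U s t (suc (i ℕ.+ j))} p∣U)) uᵢ₊₁))
        ... | inj₁ p∣tuᵢ = contradiction p∣tuᵢ (∤-* {t} p∤t p∤uᵢ)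
        ... | inj₂ p∣uⱼ  = p∣uⱼ
        up : + p ∣ U s t j → + p ∣ U s t (suc i ℕ.+ j)
        up p∣uⱼ = Signed.∣⇒∣ᵤ (≡.subst (+ p Signed.∣_) (≡.sym (U-+ s t i j)) (Signed.∣m∣n⇒∣m+n uᵢ₊₁
          (Signed.∣n⇒∣m*n (t ℤ.* U s t i) (Signed.∣ᵤ⇒∣ {i = U s t j} p∣uⱼ))))

    U-shift-* : ∀ q r →
      (+ p ∣ U s t (q * k ℕ.+ r) → + p ∣ U s t r) × (+ p ∣ U s t r → + p ∣ U s t (q * k ℕ.+ r))
    U-shift-* zero    r = id , id
    U-shift-* (suc q) r rewrite ℕ.+-assoc k (q * k) r =
      proj₁ (U-shift-* q r) ∘ proj₁ (U-shift (q * k ℕ.+ r)) ,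
      proj₂ (U-shift (q * k ℕ.+ r)) ∘ proj₂ (U-shift-* q r)

    rank∣⇒∣U : ∀ {n} → k ℕ.∣ n → + p ∣ U s t n
    rank∣⇒∣U (ℕ.divides-refl q) =
      ≡.subst (λ m → + p ∣ U s t m) (ℕ.+-identityʳ (q * k)) (proj₂ (U-shift-* q 0) (p ℕ.∣0))

    ∣U⇒rank∣ : ∀ n → + p ∣ U s t n → k ℕ.∣ n
    ∣U⇒rank∣ n p∣U with n ℕ.% k in eq
      where instance k≢0 = ℕ.>-nonZero positive
    ... | zero  = ℕ.m%n≡0⇒n∣m n k eq
      where instance k≢0 = ℕ.>-nonZero positive
    ... | suc r = contradiction (least (suc r) (s≤s z≤n) (proj₁ (U-shift-* (n ℕ./ k) (suc r))
        (≡.subst (λ m → + p ∣ U s t m) n≡ p∣U))) (ℕ.<⇒≱ (≡.subst (ℕ._< k) eq (ℕ.m%n<n n k)))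
      where
      instance k≢0 = ℕ.>-nonZero positive
      n≡ : n ≡ n ℕ./ k * k ℕ.+ suc r
      n≡ = ≡.trans (ℕ.m≡m%n+[m/n]*n n k) (≡.trans (≡.cong (ℕ._+ n ℕ./ k * k) eq) (ℕ.+-comm (suc r) _))

-- Valuations of the Lucas atoms

primePart : ∀ {p} → 2 ≤ p → ∀ c → 1 ≤ c → ∃₂ λ a m → c ≡ p ^ a * m × ¬ p ℕ.∣ m
primePart {p} 2≤p c 1≤c with ℕ.divides m c≡ ← maxExponent-∣ p c c =
  a , m , ≡.trans c≡ (ℕ.*-comm m (p ^ a)) , λ { (ℕ.divides-refl q) →
    ℕ.1+n≰n (∣⇒≤maxExponent 2≤p 1≤c (ℕ.divides q (≡.trans c≡ (ℕ.*-assoc q p (p ^ a))))) }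
  where a = maxExponent p c c

norm-1 : ∀ t → norm t 1 ≡ t
norm-1 t = ≡.trans (≡.cong ℤ.-_ (ℤ.*-identityʳ (ℤ.- t))) (ℤ.neg-involutive t)

module AtomValuations {c ℓ} (K : DomainWithRootsOfUnity c ℓ)
  {P : ℕ → RawRing.Carrier ℤ[s,t]} (atoms : IsLucasAtoms K P)
  {s t : ℤ} {p : ℕ} (p-prime : Prime p) (3≤p : 3 ≤ p) (p∤t : ¬ + p ∣ t)
  {k : ℕ} (rank : IsRankOfAppearance p (U s t) k) where

  module K = DomainWithRootsOfUnity K
  module Ext = QuadraticExtension K.commutativeRing
    (Evaluation.fromℤ K.rawRing s) (Evaluation.fromℤ K.rawRing t)
  open LucasRoots K s t Ext.commutativeRing Ext.ι-isRingHomomorphism proj₁ Ext.x Ext.x²≈sx+t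

  Pₛₜ : ℕ → ℤ
  Pₛₜ n = P n ⟨ s , t ⟩

  1≤p : 1 ≤ p
  1≤p = ℕ.≤-trans (s≤s z≤n) 3≤p

  2≤p : 2 ≤ p
  2≤p = ℕ.≤-trans (s≤s (s≤s z≤n)) 3≤p

  instance
    p≢0 : ℕ.NonZero p
    p≢0 = ℕ.>-nonZero 1≤p

    k≢0 : ℕ.NonZero k
    k≢0 = ℕ.>-nonZero (IsRankOfAppearance.positive rank)

  1≤kp^ : ∀ h → 1 ≤ k * p ^ h
  1≤kp^ h = ℕ.*-mono-≤ (IsRankOfAppearance.positive rank) (ℕ.m^n>0 p h)

  p∤norm : ∀ n → ¬ + p ∣ norm t n
  p∤norm n = ∤-^ p-prime {ℤ.- t} (p∤t ∘ ≡.subst (p ℕ.∣_) (ℤ.∣-i∣≡∣i∣ t)) n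
    ∘ ≡.subst (p ℕ.∣_) (ℤ.∣-i∣≡∣i∣ ((ℤ.- t) ℤ.^ n))

  p²∣discriminant : ∀ {n} → 1 ≤ n → k ℕ.∣ n → + (p * p) Signed.∣ discriminant (V s t n) (norm t n)
  p²∣discriminant {suc n} _ k∣n = ≡.subst (+ (p * p) Signed.∣_) (≡.sym (discriminant-identity n))
    (Signed.∣n⇒∣m*n (discriminant s t) (Signed.∣ᵤ⇒∣ {i = u ℤ.* u}
      (≡.subst (p * p ℕ.∣_) (≡.sym (ℤ.abs-* u u)) (ℕ.*-pres-∣ p∣u p∣u))))
    where
    u = U s t (suc n)
    p∣u = rank∣⇒∣U p-prime p∤t rank k∣n

  p∣discriminant : ∀ {n} → 1 ≤ n → k ℕ.∣ n → + p Signed.∣ discriminant (V s t n) (norm t n)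
  p∣discriminant 1≤n k∣n = Signed.∣-trans (Signed.∣ᵤ⇒∣ (ℕ.m∣m*n p)) (p²∣discriminant 1≤n k∣n)

  -- The case N = 1, where V₁ = s and `norm t 1` is t: the atoms over all divisors of n other than 1
  -- multiply to Uₙ. The product `1 * n` stays because it does not reduce to `n`.
  ∏-divisors : ∀ n → 1 ≤ n → ∏ Pₛₜ (newDivisors 1 (1 * n)) ≡ U s t n
  ∏-divisors n 1≤n = ≡.trans (∏-newDivisors atoms (s≤s z≤n) 1≤n) (≡.cong (λ T → U s T n) (norm-1 t))

  -- In either case a product of atoms that is prime to p is found with Pₙ among its factors. The
  -- exponent h = 0 is among those excluded, so n = k is ruled out as well.
  atom-∤ : ∀ n → 2 ≤ n → (∀ h → n ≢ k * p ^ h) → ¬ + p ∣ Pₛₜ n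
  atom-∤ n 2≤n n≢kp^ p∣Pn with k ℕ.∣? n
  ... | no k∤n = k∤n (∣U⇒rank∣ p-prime p∤t rank n (≡.subst (+ p ∣_) (∏-divisors n 1≤n)
    (∣-∏ p-prime Pₛₜ (∈-newDivisors⁺ {1} 1≤n (ℕ.*-monoʳ-≤ 1 1≤n) (ℕ.n∣m*n 1) (ℕ.>⇒∤ 2≤n)) p∣Pn)))
    where 1≤n = ℕ.<⇒≤ 2≤n
  ... | yes (ℕ.divides c n≡ck) with primePart 2≤p c (ℕ.n≢0⇒n>0 λ { ≡.refl → ℕ.m<n⇒n≢0 2≤n n≡ck })
  ... | a , m , c≡ , p∤m = ∤-U p-prime 3≤p {V s t N} {norm t N} (p∤norm N)
    (p∣discriminant (1≤kp^ a) (ℕ.m∣m*n (p ^ a))) m p∤m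
    (≡.subst (+ p ∣_) (∏-newDivisors atoms (1≤kp^ a) 1≤m)
      (∣-∏ p-prime Pₛₜ (∈-newDivisors⁺ {N} (ℕ.<⇒≤ 2≤n) (ℕ.*-mono-≤ (1≤kp^ a) 1≤m)
        (ℕ.∣-reflexive n≡Nm) n∤N) p∣Pn))
    where
    N = k * p ^ a
    1≤m : 1 ≤ m
    1≤m = ℕ.n≢0⇒n>0 λ { ≡.refl → p∤m (p ℕ.∣0) }
    n≡Nm : n ≡ N * m
    n≡Nm = ≡.trans n≡ck (≡.trans (ℕ.*-comm c k) (≡.trans (≡.cong (k *_) c≡) (≡.sym (ℕ.*-assoc k (p ^ a) m))))
    -- This places n among the new divisors: N divides n, so n ∣ N would force n = k pᵃ.
    n∤N : ¬ n ℕ.∣ N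
    n∤N n∣N = n≢kp^ a (ℕ.∣-antisym n∣N (≡.subst (N ℕ.∣_) (≡.sym n≡Nm) (ℕ.m∣m*n m)))

  valuation-rank : v p (Pₛₜ k) ≡ v p (U s t k)
  valuation-rank = ≡.trans
    (≡.sym (valuation-∏ p-prime Pₛₜ (newDivisors-unique 1 (1 * k))
      (∈-newDivisors⁺ {1} 1≤k (ℕ.*-monoʳ-≤ 1 1≤k) (ℕ.n∣m*n 1) (ℕ.>⇒∤ (2≤rank p-prime p∤t rank))) others))
    (≡.cong (v p) (∏-divisors k 1≤k))
    where
    1≤k = IsRankOfAppearance.positive rank
    -- A divisor of k of the form k p^h is both a divisor and a multiple of k, hence k itself;
    -- `atom-∤` handles the others.
    others : ∀ {d} → d ∈ newDivisors 1 (1 * k) → d ≢ k → ¬ + p ∣ Pₛₜ d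
    others {d} d∈ d≢k with 1≤d , d∣k , d∤1 ← ∈-newDivisors⁻ {1} {1 * k} d∈ =
      atom-∤ d (ℕ.≤∧≢⇒< 1≤d λ { ≡.refl → d∤1 ℕ.∣-refl }) λ h d≡ →
        d≢k (ℕ.∣-antisym (≡.subst (d ℕ.∣_) (ℕ.*-identityˡ k) d∣k)
          (≡.subst (k ℕ.∣_) (≡.sym d≡) (ℕ.m∣m*n (p ^ h))))

  valuation-rank-multiple : ∀ h → v p (Pₛₜ (k * p ^ suc h)) ≡ [ 1 ]
  valuation-rank-multiple h = ≡.trans
    (≡.sym (valuation-∏ p-prime Pₛₜ (newDivisors-unique N (N * p))
      (∈-newDivisors⁺ {N} (1≤kp^ (suc h)) (≡.subst (1 ≤_) n≡Np (1≤kp^ (suc h)))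
        (ℕ.∣-reflexive n≡Np) n∤N) others))
    (≡.trans (≡.cong (v p) (∏-newDivisors atoms (1≤kp^ h) 1≤p))
      (valuation-U-prime p-prime 3≤p (p∤norm N) (p²∣discriminant (1≤kp^ h) (ℕ.m∣m*n (p ^ h)))))
    where
    N = k * p ^ h
    n = k * p ^ suc h
    n≡Np : n ≡ N * p
    n≡Np = ≡.trans (≡.cong (k *_) (ℕ.*-comm p (p ^ h))) (≡.sym (ℕ.*-assoc k (p ^ h) p))
    p^∣⇒≤ : ∀ i j → p ^ i ℕ.∣ p ^ j → i ≤ j
    p^∣⇒≤ i j p^i∣p^j = ℕ.≮⇒≥ λ j<i →
      ℕ.<⇒≱ (ℕ.^-monoʳ-< p 2≤p j<i) (ℕ.∣⇒≤ {{ℕ.m^n≢0 p j}} p^i∣p^j)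
    n∤N : ¬ n ℕ.∣ N
    n∤N n∣N = ℕ.1+n≰n (p^∣⇒≤ (suc h) h (ℕ.*-cancelˡ-∣ k n∣N))
    -- If d = k pʲ divides k p^{h+1} but not k p^h, then j ≤ h + 1 and j > h, so d = n. Every other
    -- d falls under `atom-∤`.
    others : ∀ {d} → d ∈ newDivisors N (N * p) → d ≢ n → ¬ + p ∣ Pₛₜ d
    others {d} d∈ d≢n with 1≤d , d∣Np , d∤N ← ∈-newDivisors⁻ {N} {N * p} d∈ =
      atom-∤ d (ℕ.≤∧≢⇒< 1≤d λ { ≡.refl → d∤N (ℕ.1∣ N) }) λ j d≡ →
        d≢n (≡.trans d≡ (≡.cong (λ j → k * p ^ j) (ℕ.≤-antisym
          (p^∣⇒≤ j (suc h) (ℕ.*-cancelˡ-∣ k (≡.subst₂ ℕ._∣_ d≡ (≡.sym n≡Np) d∣Np)))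
          (ℕ.≰⇒> λ j≤h → d∤N (≡.subst (ℕ._∣ N) (≡.sym d≡) (ℕ.*-monoʳ-∣ k (^-∣ p j≤h)))))))

  -- The list `P 1` may carry trailing zeros, so the value is obtained from the fact that evaluation
  -- respects coefficientwise equality.
  atom-1 : Pₛₜ 1 ≡ 1ℤ
  atom-1 = ≡.trans (at-t.⟦⟧-cong {x = P 1} {y = RawRing.1# ℤ[s,t]} (IsLucasAtoms.P₁ atoms)) at-t.1#-homo
    where
    module at-t = IsRingHomomorphism (horner-isRingHomomorphism ℤ.+-*-commutativeRing
      (horner-isRingHomomorphism ℤ.+-*-commutativeRing
        (FromInteger.fromℤ-isRingHomomorphism ℤ.+-*-commutativeRing) s) t)

theorem14 : ∀ {c ℓ} (K : DomainWithRootsOfUnity c ℓ)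
    (P : ℕ → RawRing.Carrier ℤ[s,t]) → IsLucasAtoms K P →
    (s t : ℤ) (p : ℕ) → Prime p → 3 ≤ p → ¬ (+ p ∣ t) →
    (k : ℕ) → IsRankOfAppearance p (U s t) k →
    (n : ℕ) → 1 ≤ n →
    (n ≡ k → v p (P n ⟨ s , t ⟩) ≡ v p (U s t k))
    × (∀ h → 1 ≤ h → n ≡ k * p ^ h → v p (P n ⟨ s , t ⟩) ≡ [ 1 ])
    × (n ≢ k → (∀ h → 1 ≤ h → n ≢ k * p ^ h) → v p (P n ⟨ s , t ⟩) ≡ [ 0 ])
theorem14 K P atoms s t p p-prime 3≤p p∤t k rank n 1≤n =
  (λ { ≡.refl → valuation-rank }) ,
  (λ { (suc h) _ ≡.refl → valuation-rank-multiple h }) ,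
  λ n≢k n≢kp^ → ∤⇒valuation≡0 p-prime (P n ⟨ s , t ⟩) (case-∤ n≢k n≢kp^)
  where
  open AtomValuations K atoms p-prime 3≤p p∤t rank
  case-∤ : n ≢ k → (∀ h → 1 ≤ h → n ≢ k * p ^ h) → ¬ + p ∣ P n ⟨ s , t ⟩
  case-∤ n≢k n≢kp^ with n ℕ.≟ 1
  -- Index 1 stands apart because `atom-∤` starts at index 2.
  ... | yes ≡.refl = ∤1 p-prime ∘ ≡.subst (+ p ∣_) atom-1
  ... | no  n≢1    = atom-∤ n (ℕ.≤∧≢⇒< 1≤n (n≢1 ∘ ≡.sym))
    -- The exponent 0 required by `atom-∤` is the excluded case n = k.
    λ { zero n≡ → n≢k (≡.trans n≡ (ℕ.*-identityʳ k)) ; (suc h) → n≢kp^ (suc h) (s≤s z≤n) }
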